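{- Let $G$ be a connected block graph of order at least $2$. Then the following are equivalent: (a) $G$ is $\alpha$-excellent; (b) $G\in\mathcal{F}$; (c) $G$ has a perfect block-cover.
   Context: All graphs are finite and simple. A graph is $\alpha$-excellent if every vertex is contained in some maximum independent set. A block is a maximal connected subgraph without a cut-vertex of its own; a block graph is a graph each of whose blocks is complete. A perfect block-cover of a block graph $G$ is a family of pairwise vertex-disjoint blocks of $G$ such that every vertex of $G$ belongs to some block of the family. For a complete graph $K_n$ with vertices $v_1,\ldots,v_n$ ($n\ge1$) and complete graphs $H_1,\ldots,H_n$, the general corona $K_n\circ\{H_1,\ldots,H_n\}$ is the disjoint union of $K_n,H_1,\ldots,H_n$ with $v_i$ joined to every vertex of $H_i$ for each $i$; the complete subgraph on $v_1,\ldots,v_n$ is its body. The family $\mathcal{F}$ is the smallest family of graphs that contains every complete graph of order at least $2$ and is closed under the following operation: if $G'\in\mathcal{F}$, $v\in V(G')$, and $H$ is a general corona of a complete graph by a family of complete graphs, then the graph obtained from the disjoint union $G'\cup H$ by adding all edges joining $v$ to the vertices of the body of $H$ belongs to $\mathcal{F}$. -}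

module Defs where

open import Data.Nat using (ℕ; suc; _≤_; _≡ᵇ_)
open import Data.Fin using (Fin; toℕ)
open import Data.Fin.Properties using (_≟_)
open import Data.Bool using (Bool; true; false; not; _∧_)
open import Data.Sum using (_⊎_; inj₁; inj₂)
open import Data.Product using (Σ; _×_; _,_; ∃-syntax)
open import Data.List using (List)
open import Data.List.Relation.Unary.All using (All)
open import Data.List.Relation.Unary.Any using (Any)
open import Data.List.Relation.Unary.AllPairs using (AllPairs)
open import Data.Fin.Subset using (Subset; _∈_; ∣_∣; _⊆_; _-_; ⊤; Nonempty)
open import Relation.Nullary using (¬_)
open import Relation.Nullary.Decidable using (⌊_⌋)
open import Relation.Binary.PropositionalEquality using (_≡_; _≢_)
open import Function.Bundles using (_↔_; Inverse)
open import Data.Empty using (⊥)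

record Graph (V : Set) : Set where
  field adj : V → V → Bool
open Graph public

Adj : {V : Set} → Graph V → V → V → Set
Adj G u v = adj G u v ≡ true

IsSimple : {V : Set} → Graph V → Set
IsSimple G = (∀ u v → adj G u v ≡ adj G v u) × (∀ u → adj G u u ≡ false)

module _ {n : ℕ} (G : Graph (Fin n)) where

  Independent : Subset n → Set
  Independent S = ∀ u v → u ∈ S → v ∈ S → ¬ Adj G u v

  MaximumIndependent : Subset n → Set
  MaximumIndependent S =
    Independent S × (∀ T → Independent T → ∣ T ∣ ≤ ∣ S ∣)

  AlphaExcellent : Set
  AlphaExcellent = ∀ v → ∃[ S ] (MaximumIndependent S × v ∈ S)

  data PathIn (S : Subset n) : Fin n → Fin n → Set where
    here : ∀ {u} → u ∈ S → PathIn S u u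
    step : ∀ {u w v} → u ∈ S → Adj G u w → PathIn S w v → PathIn S u v

  ConnectedOn : Subset n → Set
  ConnectedOn S = ∀ u v → u ∈ S → v ∈ S → PathIn S u v

  Connected : Set
  Connected = ConnectedOn ⊤

  -- G[S] (assumed connected) has a cut-vertex of its own:
  -- a vertex of S whose removal disconnects G[S]
  HasCutVertex : Subset n → Set
  HasCutVertex S = ∃[ v ] (v ∈ S × ¬ ConnectedOn (S - v))

  -- a block: a maximal connected subgraph without a cut-vertex of its own
  -- (represented by its vertex set; blocks are induced subgraphs)
  IsBlock : Subset n → Set
  IsBlock S =
    Nonempty S × ConnectedOn S × ¬ HasCutVertex S ×
    (∀ T → S ⊆ T → Nonempty T → ConnectedOn T → ¬ HasCutVertex T → T ⊆ S)

  IsBlockGraph : Set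
  IsBlockGraph = ∀ S → IsBlock S → ∀ u v → u ∈ S → v ∈ S → u ≢ v → Adj G u v

  Disjoint : Subset n → Subset n → Set
  Disjoint S T = ∀ v → v ∈ S → v ∈ T → ⊥

  HasPerfectBlockCover : Set
  HasPerfectBlockCover =
    ∃[ Bs ] (All IsBlock Bs × AllPairs Disjoint Bs × (∀ v → Any (v ∈_) Bs))

eqF : {m : ℕ} → Fin m → Fin m → Bool
eqF i j = ⌊ i ≟ j ⌋

-- vertices of the general corona K_{k+1} ∘ {H_0,...,H_k} with
-- H_i = K_{h i + 1} (complete graphs of order ≥ 1):
-- inj₁ i is the body vertex v_i, inj₂ (i , a) is vertex a of H_i
CoronaV : (k : ℕ) → (Fin (suc k) → ℕ) → Set
CoronaV k h = Fin (suc k) ⊎ Σ (Fin (suc k)) (λ i → Fin (suc (h i)))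

coronaAdj : (k : ℕ) (h : Fin (suc k) → ℕ) → CoronaV k h → CoronaV k h → Bool
coronaAdj k h (inj₁ i) (inj₁ j) = not (eqF i j)
coronaAdj k h (inj₁ i) (inj₂ (j , _)) = eqF i j
coronaAdj k h (inj₂ (i , _)) (inj₁ j) = eqF i j
coronaAdj k h (inj₂ (i , a)) (inj₂ (j , b)) = eqF i j ∧ not (toℕ a ≡ᵇ toℕ b)

attach : {m : ℕ} → Graph (Fin m) → Fin m → (k : ℕ) (h : Fin (suc k) → ℕ) →
         Graph (Fin m ⊎ CoronaV k h)
adj (attach G' v k h) (inj₁ x) (inj₁ y) = adj G' x y
adj (attach G' v k h) (inj₁ x) (inj₂ (inj₁ _)) = eqF x v
adj (attach G' v k h) (inj₁ x) (inj₂ (inj₂ _)) = false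
adj (attach G' v k h) (inj₂ (inj₁ _)) (inj₁ y) = eqF y v
adj (attach G' v k h) (inj₂ (inj₂ _)) (inj₁ y) = false
adj (attach G' v k h) (inj₂ a) (inj₂ b) = coronaAdj k h a b

Iso : {n : ℕ} {W : Set} → Graph (Fin n) → Graph W → Set
Iso {n} {W} G H =
  Σ (Fin n ↔ W) λ f →
    ∀ x y → adj G x y ≡ adj H (Inverse.to f x) (Inverse.to f y)

data InF : {n : ℕ} → Graph (Fin n) → Set where
  complete : ∀ {n} (G : Graph (Fin n)) → 2 ≤ n →
             (∀ i j → adj G i j ≡ not (eqF i j)) → InF G
  extend : ∀ {m n} {G' : Graph (Fin m)} → InF G' →
           (v : Fin m) (k : ℕ) (h : Fin (suc k) → ℕ) (G : Graph (Fin n)) →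
           Iso G (attach G' v k h) → InF G

{-# OPTIONS --safe #-}

-- In a block graph every biconnected vertex set is a clique, so blocks and maximal cliques coincide, and two neighbours
-- of v that are connected in G − v are adjacent.  Hence, rooting G by breadth-first search, every vertex other than the
-- root has a unique parent, every edge joins a child to its parent or two siblings, and sibling adjacency is transitive.
--
-- Excellent ⇒ cover: select bottom-up each vertex without a selected child.  This yields a partition into cliques with as
-- many parts as some independent set has vertices, so every maximum independent set meets every part.  If z were adjacent
-- to all of a part not containing it, a maximum independent set through z would miss that part; so all parts are blocks.
--
-- Cover ⇒ excellent: root G at the given vertex r and choose from each further block of the cover a vertex that is not
-- the one nearest to r.
--
-- Cover ⇒ 𝓕: start with the covering block of the root.  If z is a missing vertex whose parent v is present, the missing
-- block through v and z minus v is the body of a corona whose leaves are the remaining vertices of the covering blocks.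

module Submission where

open import Defs
open import Data.Nat using (ℕ; zero; suc; _≤_; _<_; _+_; _∸_; _≡ᵇ_; z≤n; s≤s; s≤s⁻¹)
open import Data.Nat.Properties as ℕₚ using (≤-trans; ≤-refl; ≤-reflexive)
open import Data.Fin using (Fin; zero; suc; toℕ)
open import Data.Fin.Properties using (_≟_; any?; suc-injective)
open import Data.Fin.Subset using (Subset; _∈_; _∉_; ∣_∣; _⊆_; _-_; _∪_; ⁅_⁆; ⊤;
  Nonempty; inside; outside)
open import Data.Fin.Subset.Properties
open import Data.Bool using (Bool; true; false; not; _∧_)
import Data.Bool.Properties as Boolₚ
open import Data.Empty using (⊥; ⊥-elim)
open import Data.List using (List; map; filter; allFin)
open import Data.List.Membership.Propositional using (find; lose) renaming (_∈_ to _∈ₗ_)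
open import Data.List.Membership.Propositional.Properties using (∈-map⁺; ∈-filter⁺; ∈-allFin)
import Data.List.Relation.Unary.All as All
import Data.List.Relation.Unary.All.Properties as Allₚ
import Data.List.Relation.Unary.Any as Any
open import Data.List.Relation.Unary.AllPairs as AllPairs using (AllPairs)
import Data.List.Relation.Unary.AllPairs.Properties as AllPairsₚ
import Data.List.Relation.Unary.Unique.Propositional.Properties as Uniqueₚ
open import Data.Product using (Σ; ∃; _×_; _,_; proj₁; proj₂; ∃-syntax)
open import Data.Sum using (_⊎_; inj₁; inj₂)
import Data.Sum.Properties as Sumₚ
import Data.Unit as Unit
open import Data.Vec using ([]; _∷_; tabulate; here; there)
open import Data.Vec.Properties using (lookup⇒[]=; []=⇒lookup; lookup∘tabulate; tabulate-cong)
open import Function.Bundles using (Inverse; mk⇔; mk↔ₛ′; _⇔_)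
open import Relation.Binary.Definitions using (tri<; tri≈; tri>)
open import Relation.Binary.PropositionalEquality
  using (_≡_; _≢_; refl; sym; trans; cong; cong₂; subst; ≢-sym)
open import Relation.Nullary using (¬_; Dec; yes; no; does; contradiction)
open import Relation.Nullary.Decidable using (dec-true; decidable-stable; does-⇔; _×-dec_; _⊎-dec_; ¬?)

private variable
  n : ℕ

-- Finite sets

fromDec : {P : Fin n → Set} → (∀ x → Dec (P x)) → Subset n
fromDec P? = tabulate (λ x → does (P? x))

module _ {P : Fin n → Set} (P? : ∀ x → Dec (P x)) where

  ∈-fromDec⁺ : ∀ {x} → P x → x ∈ fromDec P?
  ∈-fromDec⁺ {x} px =
    lookup⇒[]= x _ (trans (lookup∘tabulate _ x) (dec-true (P? x) px))

  ∈-fromDec⁻ : ∀ {x} → x ∈ fromDec P? → P x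
  ∈-fromDec⁻ {x} x∈ with P? x | trans (sym (lookup∘tabulate (λ y → does (P? y)) x)) ([]=⇒lookup x∈)
  ... | yes px | _ = px
  ... | no _   | ()

-- Subsets are Boolean vectors, so equivalent predicates give propositionally equal sets; `choose`
-- then cannot tell them apart.
fromDec-cong : {P Q : Fin n → Set} (P? : ∀ x → Dec (P x)) (Q? : ∀ x → Dec (Q x)) →
               (∀ x → P x → Q x) → (∀ x → Q x → P x) → fromDec P? ≡ fromDec Q?
fromDec-cong P? Q? P⇒Q Q⇒P =
  tabulate-cong (λ x → does-⇔ (mk⇔ (P⇒Q x) (Q⇒P x)) (P? x) (Q? x))

-- A canonical representative: equal subsets yield equal elements, which makes labels of parts well
-- defined. The default `d` is returned only for the empty set.
choose : Fin n → Subset n → Fin n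
choose d S with nonempty? S
... | yes (x , _) = x
... | no _        = d

choose∈ : ∀ d {S : Subset n} {x} → x ∈ S → choose d S ∈ S
choose∈ d {S} {x} x∈S with nonempty? S
... | yes (_ , y∈S) = y∈S
... | no empty      = contradiction (x , x∈S) empty

-- By induction along `T`: each member of `T` removes its own image from `S`, and injectivity keeps
-- the remaining images inside what is left.
∣∣-injection : ∀ {m n} (T : Subset m) (S : Subset n) (f : Fin m → Fin n) →
               (∀ x → x ∈ T → f x ∈ S) →
               (∀ x y → x ∈ T → y ∈ T → f x ≡ f y → x ≡ y) →
               ∣ T ∣ ≤ ∣ S ∣
∣∣-injection [] S f into inj = z≤n
∣∣-injection (outside ∷ T) S f into inj =
  ∣∣-injection T S (λ x → f (suc x)) (λ x x∈T → into (suc x) (there x∈T))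
    (λ x y x∈T y∈T e → suc-injective (inj _ _ (there x∈T) (there y∈T) e))
∣∣-injection (inside ∷ T) S f into inj =
  ≤-trans (s≤s (∣∣-injection T (S - f zero) (λ x → f (suc x)) into′
                 (λ x y x∈T y∈T e → suc-injective (inj _ _ (there x∈T) (there y∈T) e))))
          (x∈p⇒∣p-x∣<∣p∣ (into zero here))
  where
  into′ : ∀ x → x ∈ T → f (suc x) ∈ S - f zero
  into′ x x∈T = x∈p∧x≢y⇒x∈p-y (into (suc x) (there x∈T))
    (λ e → contradiction (inj _ _ (there x∈T) here e) λ ())

x∉p-x : ∀ {S : Subset n} {x} → x ∉ S - x
x∉p-x {S = _ ∷ S} {zero}  ()
x∉p-x {S = _ ∷ S} {suc x} (there x∈) = x∉p-x x∈

-- Blocks, cliques and paths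

IsClique : Graph (Fin n) → Subset n → Set
IsClique G S = ∀ u v → u ∈ S → v ∈ S → u ≢ v → Adj G u v

Biconnected : Graph (Fin n) → Subset n → Set
Biconnected G S = Nonempty S × ConnectedOn G S × ¬ HasCutVertex G S

module _ (G : Graph (Fin n)) where

  Adj? : ∀ u v → Dec (Adj G u v)
  Adj? u v = adj G u v Boolₚ.≟ true

  source∈ : ∀ {S u v} → PathIn G S u v → u ∈ S
  source∈ (here u∈)     = u∈
  source∈ (step u∈ _ _) = u∈

  target∈ : ∀ {S u v} → PathIn G S u v → v ∈ S
  target∈ (here u∈)    = u∈
  target∈ (step _ _ π) = target∈ π

  path-mono : ∀ {S T u v} → S ⊆ T → PathIn G S u v → PathIn G T u v
  path-mono S⊆T (here u∈)     = here (S⊆T u∈)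
  path-mono S⊆T (step u∈ a π) = step (S⊆T u∈) a (path-mono S⊆T π)

  path-trans : ∀ {S u v w} → PathIn G S u v → PathIn G S v w → PathIn G S u w
  path-trans (here _)      ρ = ρ
  path-trans (step u∈ a π) ρ = step u∈ a (path-trans π ρ)

  clique⇒connected : ∀ {S} → IsClique G S → ConnectedOn G S
  clique⇒connected clique u v u∈ v∈ with u ≟ v
  ... | yes refl = here u∈
  ... | no u≢v   = step u∈ (clique u v u∈ v∈ u≢v) (here v∈)

  clique⇒biconnected : ∀ {S} → Nonempty S → IsClique G S → Biconnected G S
  clique⇒biconnected {S} ne clique =
    ne , clique⇒connected clique , λ { (v , _ , ¬conn) → ¬conn (clique⇒connected
      λ x y x∈ y∈ → clique x y (p─q⊆p S ⁅ v ⁆ x∈) (p─q⊆p S ⁅ v ⁆ y∈)) }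

  -- Whether a subgraph is connected is not obviously decidable, but adjacency is, so the double negation is harmless.
  biconnected⊆block : ∀ k S → n ≤ k + ∣ S ∣ → Biconnected G S →
                      ¬ ¬ (∃[ B ] (IsBlock G B × S ⊆ B))
  biconnected⊆block k S bound (ne , conn , ¬cut) ¬block =
    ¬block (S , (ne , conn , ¬cut , maximal) , λ x∈ → x∈)
    where
    -- `k` bounds the number of vertices outside `S`. A strictly larger biconnected set costs one
    -- unit of it, and at zero there is no room for one.
    enlarge : ∀ k T → n ≤ k + ∣ S ∣ → S ⊆ T → ∣ S ∣ < ∣ T ∣ → Biconnected G T → ⊥
    enlarge zero T bound _ S<T _ =
      ℕₚ.<-irrefl refl (≤-trans S<T (≤-trans (∣p∣≤n T) bound))
    enlarge (suc k) T bound S⊆T S<T bic =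
      biconnected⊆block k T
        (≤-trans bound (≤-trans (≤-reflexive (sym (ℕₚ.+-suc k ∣ S ∣))) (ℕₚ.+-monoʳ-≤ k S<T)))
        bic (λ { (B , block , T⊆B) → ¬block (B , block , λ x∈ → T⊆B (S⊆T x∈)) })

    maximal : ∀ T → S ⊆ T → Nonempty T → ConnectedOn G T → ¬ HasCutVertex G T → T ⊆ S
    maximal T S⊆T neT connT ¬cutT {t} t∈T = decidable-stable (t ∈? S) λ t∉S →
      enlarge k T bound S⊆T (p⊂q⇒∣p∣<∣q∣ (S⊆T , t , t∈T , t∉S)) (neT , connT , ¬cutT)

  biconnected⇒clique : IsBlockGraph G → ∀ {S} → Biconnected G S → IsClique G S
  biconnected⇒clique blockGraph {S} bic u v u∈ v∈ u≢v =
    decidable-stable (Adj? u v) λ ¬adj →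
      biconnected⊆block n S (ℕₚ.m≤m+n n ∣ S ∣) bic λ { (B , block , S⊆B) →
        ¬adj (blockGraph B block u v (S⊆B u∈) (S⊆B v∈) u≢v) }

  -- The index is the exact set of visited vertices, so `u ∉ S` rules out repetitions and the set
  -- can later be completed to a cycle.
  data SimplePath : Subset n → Fin n → Fin n → Set where
    here : ∀ {u} → SimplePath ⁅ u ⁆ u u
    step : ∀ {S u w v} → u ∉ S → Adj G u w → SimplePath S w v → SimplePath (⁅ u ⁆ ∪ S) u v

  private
    u∈⁅u⁆∪ : ∀ {u} {S : Subset n} → u ∈ ⁅ u ⁆ ∪ S
    u∈⁅u⁆∪ {u} {S} = p⊆p∪q S (x∈⁅x⁆ u)

  start∈ : ∀ {S u v} → SimplePath S u v → u ∈ S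
  start∈ here         = x∈⁅x⁆ _
  start∈ (step _ _ _) = u∈⁅u⁆∪

  suffix : ∀ {S u v w} → SimplePath S u v → w ∈ S → ∃[ T ] (T ⊆ S × SimplePath T w v)
  suffix {w = w} (here {u}) w∈ with refl ← x∈⁅y⁆⇒x≡y u w∈ = _ , (λ x∈ → x∈) , here
  suffix {w = w} (step {S} {u} u∉ a π) w∈ with x∈p∪q⁻ ⁅ u ⁆ S w∈
  ... | inj₁ w∈u with refl ← x∈⁅y⁆⇒x≡y u w∈u = _ , (λ x∈ → x∈) , step u∉ a π
  ... | inj₂ w∈S with suffix π w∈S
  ...   | T , T⊆S , ρ = T , (λ x∈ → q⊆p∪q ⁅ u ⁆ S (T⊆S x∈)) , ρ

  -- Loop erasure: if the new first vertex already occurs on the simplified rest, the path restarts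
  -- at that occurrence.
  simplify : ∀ {T u v} → PathIn G T u v → ∃[ S ] (S ⊆ T × SimplePath S u v)
  simplify {T} (here {u} u∈) =
    _ , (λ x∈ → subst (_∈ T) (sym (x∈⁅y⁆⇒x≡y u x∈)) u∈) , here
  simplify {T} (step {u} u∈ a π) with simplify π
  ... | S , S⊆T , ρ with u ∈? S
  ...   | yes u∈S with suffix ρ u∈S
  ...     | S′ , S′⊆S , σ = S′ , (λ x∈ → S⊆T (S′⊆S x∈)) , σ
  simplify {T} (step {u} u∈ a π) | S , S⊆T , ρ | no u∉S = _ , sub , step u∉S a ρ
    where
    sub : ⁅ u ⁆ ∪ S ⊆ T
    sub x∈ with x∈p∪q⁻ ⁅ u ⁆ S x∈
    ... | inj₁ x∈u = subst (_∈ T) (sym (x∈⁅y⁆⇒x≡y u x∈u)) u∈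
    ... | inj₂ x∈S = S⊆T x∈S

  toTarget : ∀ {S u v w} → SimplePath S u v → w ∈ S → PathIn G S w v
  toTarget (here {u}) w∈ with refl ← x∈⁅y⁆⇒x≡y u w∈ = here w∈
  toTarget (step {S} {u} u∉ a π) w∈ with x∈p∪q⁻ ⁅ u ⁆ S w∈
  ... | inj₁ w∈u with refl ← x∈⁅y⁆⇒x≡y u w∈u =
        step w∈ a (path-mono (q⊆p∪q ⁅ u ⁆ S) (toTarget π (start∈ π)))
  ... | inj₂ w∈S = path-mono (q⊆p∪q ⁅ u ⁆ S) (toTarget π w∈S)

  private
    -widen : ∀ {u z} {S : Subset n} → S - z ⊆ (⁅ u ⁆ ∪ S) - z
    -widen {u} {z} {S} x∈ =
      x∈p∧x≢y⇒x∈p-y (q⊆p∪q ⁅ u ⁆ S (p─q⊆p S ⁅ z ⁆ x∈)) λ { refl → x∉p-x x∈ }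

  -- Deleting `z` cuts a simple path into at most two pieces, and each piece contains an end of the
  -- path.
  escape : ∀ {S u v} → SimplePath S u v → ∀ z w → w ∈ S → w ≢ z →
           PathIn G (S - z) u w ⊎ PathIn G (S - z) w v
  escape (here {u}) z w w∈ w≢z with refl ← x∈⁅y⁆⇒x≡y u w∈ =
    inj₁ (here (x∈p∧x≢y⇒x∈p-y w∈ w≢z))
  escape (step {S} {u} u∉ a π) z w w∈ w≢z with x∈p∪q⁻ ⁅ u ⁆ S w∈
  ... | inj₁ w∈u with refl ← x∈⁅y⁆⇒x≡y u w∈u = inj₁ (here (x∈p∧x≢y⇒x∈p-y w∈ w≢z))
  ... | inj₂ w∈S with u ≟ z
  ...   | yes refl = inj₂ (path-mono widen (toTarget π w∈S))
    where
    widen : S ⊆ (⁅ u ⁆ ∪ S) - u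
    widen x∈S = x∈p∧x≢y⇒x∈p-y (q⊆p∪q ⁅ u ⁆ S x∈S) λ { refl → u∉ x∈S }
  ...   | no u≢z with escape π z w w∈S w≢z
  ...     | inj₁ ρ = inj₁ (step (x∈p∧x≢y⇒x∈p-y u∈⁅u⁆∪ u≢z) a (path-mono -widen ρ))
  ...     | inj₂ ρ = inj₂ (path-mono -widen ρ)

module SimpleGraph (G : Graph (Fin n)) (simple : IsSimple G) where

  Adj-sym : ∀ {u v} → Adj G u v → Adj G v u
  Adj-sym {u} {v} a = trans (proj₁ simple v u) a

  Adj⇒≢ : ∀ {u v} → Adj G u v → u ≢ v
  Adj⇒≢ {u} a refl with () ← trans (sym a) (proj₂ simple u)

  path-sym : ∀ {S u v} → PathIn G S u v → PathIn G S v u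
  path-sym {S} {u} π = go (here (source∈ G π)) π
    where
    go : ∀ {w v} → PathIn G S w u → PathIn G S w v → PathIn G S v u
    go ρ (here _)     = ρ
    go ρ (step _ a π) = go (step (source∈ G π) (Adj-sym a) ρ) π

  -- The vertex v closes a simple path from x to y into a cycle, which is biconnected.
  neighbours-joined : IsBlockGraph G → ∀ {v x y} → Adj G v x → Adj G v y →
                      PathIn G (⊤ - v) x y → x ≢ y → Adj G x y
  neighbours-joined blockGraph {v} {x} {y} vx vy π x≢y with simplify G π
  ... | S , S⊆ , ρ = biconnected⇒clique G blockGraph
          ((v , v∈) , hub⇒connected _ v toHub , λ { (z , _ , ¬conn) → ¬conn (uncut z) })
          x y (S⊆C x∈S) (S⊆C y∈S) x≢y
    where
    C = ⁅ v ⁆ ∪ S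
    v∈ : v ∈ C
    v∈ = p⊆p∪q S (x∈⁅x⁆ v)
    S⊆C : S ⊆ C
    S⊆C = q⊆p∪q ⁅ v ⁆ S
    x∈S : x ∈ S
    x∈S = start∈ G ρ
    y∈S : y ∈ S
    y∈S = target∈ G (toTarget G ρ x∈S)
    v∉S : v ∉ S
    v∉S v∈S = x∉p-x (S⊆ v∈S)

    hub⇒connected : ∀ T h → (∀ w → w ∈ T → PathIn G T w h) → ConnectedOn G T
    hub⇒connected T h to a b a∈ b∈ = path-trans G (to a a∈) (path-sym (to b b∈))

    toHub : ∀ w → w ∈ C → PathIn G C w v
    toHub w w∈ with x∈p∪q⁻ ⁅ v ⁆ S w∈
    ... | inj₁ w∈v with refl ← x∈⁅y⁆⇒x≡y v w∈v = here w∈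
    ... | inj₂ w∈S = path-trans G (path-mono G S⊆C τ)
                       (step (S⊆C (target∈ G τ)) (Adj-sym vy) (here v∈))
      where τ = toTarget G ρ w∈S

    -- Without `v` the simple path itself remains, joined up at `y`. Without another vertex `z`,
    -- each remaining piece of the path reaches `v` through `x` or through `y`.
    uncut : ∀ z → ConnectedOn G (C - z)
    uncut z with v ≟ z
    ... | yes refl = hub⇒connected _ y λ w w∈ →
                       path-mono G v-free (toTarget G ρ (stays w w∈))
      where
      v-free : S ⊆ C - v
      v-free x∈ = x∈p∧x≢y⇒x∈p-y (S⊆C x∈) λ { refl → v∉S x∈ }
      stays : ∀ w → w ∈ C - v → w ∈ S
      stays w w∈ with x∈p∪q⁻ ⁅ v ⁆ S (p─q⊆p C ⁅ v ⁆ w∈)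
      ... | inj₁ w∈v with refl ← x∈⁅y⁆⇒x≡y v w∈v = contradiction w∈ x∉p-x
      ... | inj₂ w∈S = w∈S
    ... | no v≢z = hub⇒connected _ v to
      where
      v∈- : v ∈ C - z
      v∈- = x∈p∧x≢y⇒x∈p-y v∈ v≢z
      widen : S - z ⊆ C - z
      widen x∈ = x∈p∧x≢y⇒x∈p-y (S⊆C (p─q⊆p S ⁅ z ⁆ x∈)) λ { refl → x∉p-x x∈ }
      to : ∀ w → w ∈ C - z → PathIn G (C - z) w v
      to w w∈ with x∈p∪q⁻ ⁅ v ⁆ S (p─q⊆p C ⁅ z ⁆ w∈)
      ... | inj₁ w∈v with refl ← x∈⁅y⁆⇒x≡y v w∈v = here w∈
      ... | inj₂ w∈S with escape G ρ z w w∈S (λ { refl → x∉p-x w∈ })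
      ...   | inj₁ σ = path-trans G (path-sym (path-mono G widen σ))
                         (step (widen (source∈ G σ)) (Adj-sym vx) (here v∈-))
      ...   | inj₂ σ = path-trans G (path-mono G widen σ)
                         (step (widen (target∈ G σ)) (Adj-sym vy) (here v∈-))

-- Rooted block graphs

least : {P : ℕ → Set} → (∀ k → Dec (P k)) → ∀ k → P k →
        ∃[ m ] (P m × ∀ j → P j → m ≤ j)
least P? k pk with P? 0
... | yes p₀ = 0 , p₀ , λ _ _ → z≤n
least P? zero    pk | no ¬p₀ = contradiction pk ¬p₀
least P? (suc k) pk | no ¬p₀ with least (λ j → P? (suc j)) k pk
... | m , pm , min = suc m , pm , λ { zero p₀    → contradiction p₀ ¬p₀
                                    ; (suc j) pj → s≤s (min j pj) }

bounded : ∀ {n} (f : Fin n → ℕ) → ∃[ N ] (∀ x → f x < N)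
bounded {zero}  f = 0 , λ ()
bounded {suc n} f with bounded (λ x → f (suc x))
... | N , f<N = suc (f zero) + N , λ
      { zero    → ℕₚ.m≤m+n _ N
      ; (suc x) → ≤-trans (f<N x) (ℕₚ.m≤n+m N _) }

-- Adjacency is part of the notion: children of one vertex that lie in different blocks are not
-- siblings.
record Siblings (G : Graph (Fin n)) (r : Fin n) (parent : Fin n → Fin n) (x y : Fin n) : Set where
  constructor siblings
  field
    nonrootˡ    : x ≢ r
    nonrootʳ    : y ≢ r
    same-parent : parent x ≡ parent y
    adjacent    : Adj G x y

open Siblings

-- The outcome of the breadth-first search without the search. The convention `parent-root` keeps
-- `parent` total, and `bound` supplies fuel for recursion towards greater depth.
record Rooted (G : Graph (Fin n)) (r : Fin n) : Set where
  field
    depth         : Fin n → ℕ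
    bound         : ℕ
    depth<bound   : ∀ x → depth x < bound
    parent        : Fin n → Fin n
    parent-root   : parent r ≡ r
    parent-adj    : ∀ {x} → x ≢ r → Adj G x (parent x)
    parent-depth  : ∀ {x} → x ≢ r → depth x ≡ suc (depth (parent x))

    edge          : ∀ {x y} → Adj G x y →
                    (y ≢ r × x ≡ parent y) ⊎ (x ≢ r × y ≡ parent x) ⊎
                    Siblings G r parent x y
    siblings-join : ∀ {x y z} → Siblings G r parent x y → Siblings G r parent y z →
                    x ≢ z → Adj G x z

module BreadthFirst (G : Graph (Fin n)) (simple : IsSimple G)
                    (connected : Connected G) (blockGraph : IsBlockGraph G) (r : Fin n) where
  open SimpleGraph G simple

  -- Reachability from `r` in at most `k` steps. Unlike `PathIn` it is decidable by recursion, so a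
  -- least `k` can be found.
  Reach : ℕ → Fin n → Set
  Reach zero    x = x ≡ r
  Reach (suc k) x = Reach k x ⊎ ∃[ y ] (Reach k y × Adj G y x)

  reach? : ∀ k x → Dec (Reach k x)
  reach? zero    x = x ≟ r
  reach? (suc k) x = reach? k x ⊎-dec any? (λ y → reach? k y ×-dec Adj? G y x)

  reached : ∀ x → ∃[ k ] Reach k x
  reached x = go 0 refl (connected r x ∈⊤ ∈⊤)
    where
    go : ∀ k {u} → Reach k u → PathIn G ⊤ u x → ∃[ m ] Reach m x
    go k ρ (here _)     = k , ρ
    go k ρ (step _ a π) = go (suc k) (inj₂ (_ , ρ , a)) π

  shortest : ∀ x → ∃[ m ] (Reach m x × ∀ j → Reach j x → m ≤ j)
  shortest x = least (λ k → reach? k x) (proj₁ (reached x)) (proj₂ (reached x))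

  -- Unfolded, depth would contain the decisions x ≟ r, and `with x ≟ r` would break its occurrences.
  abstract
    depth : Fin n → ℕ
    depth x = proj₁ (shortest x)

    reach-depth : ∀ x → Reach (depth x) x
    reach-depth x = proj₁ (proj₂ (shortest x))

    depth-min : ∀ {j} x → Reach j x → depth x ≤ j
    depth-min x = proj₂ (proj₂ (shortest x)) _

  depth-step : ∀ {x y} → Adj G x y → depth y ≤ suc (depth x)
  depth-step {x} {y} a = depth-min y (inj₂ (x , reach-depth x , a))

  depth-root : depth r ≡ 0
  depth-root = ℕₚ.n≤0⇒n≡0 (depth-min r refl)

  depth≡0⇒root : ∀ {x} → depth x ≡ 0 → x ≡ r
  depth≡0⇒root {x} e = subst (λ k → Reach k x) e (reach-depth x)

  -- The last step of a shortest walk from `r`: minimality excludes standing still and forces the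
  -- previous vertex to be exactly one level nearer to `r`.
  predecessor : ∀ {x} → x ≢ r → ∃[ y ] (Adj G x y × depth x ≡ suc (depth y))
  predecessor {x} x≢r = go (depth x) refl (reach-depth x)
    where
    go : ∀ k → depth x ≡ k → Reach k x → ∃[ y ] (Adj G x y × depth x ≡ suc (depth y))
    go zero    e x≡r      = contradiction x≡r x≢r
    go (suc k) e (inj₁ ρ) =
      contradiction (≤-trans (≤-reflexive (sym e)) (depth-min x ρ)) (ℕₚ.<-irrefl refl)
    go (suc k) e (inj₂ (y , ρ , a)) = y , Adj-sym a , ℕₚ.≤-antisym
      (≤-trans (≤-reflexive e)
        (s≤s (s≤s⁻¹ (≤-trans (≤-reflexive (sym e)) (depth-step a)))))
      (≤-trans (s≤s (depth-min y ρ)) (≤-reflexive (sym e)))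

  parent-data : ∀ x → ∃[ y ] ((x ≡ r → y ≡ r) × (x ≢ r → Adj G x y × depth x ≡ suc (depth y)))
  parent-data x = case (x ≟ r)
    where
    case : Dec (x ≡ r) → _
    case (yes x≡r) = r , (λ _ → refl) , λ x≢r → contradiction x≡r x≢r
    case (no x≢r)  = proj₁ (predecessor x≢r) , (λ x≡r → contradiction x≡r x≢r) ,
                     λ _ → proj₂ (predecessor x≢r)

  parent : Fin n → Fin n
  parent x = proj₁ (parent-data x)

  parent-root : parent r ≡ r
  parent-root = proj₁ (proj₂ (parent-data r)) refl

  parent-adj : ∀ {x} → x ≢ r → Adj G x (parent x)
  parent-adj {x} x≢r = proj₁ (proj₂ (proj₂ (parent-data x)) x≢r)

  parent-depth : ∀ {x} → x ≢ r → depth x ≡ suc (depth (parent x))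
  parent-depth {x} x≢r = proj₂ (proj₂ (proj₂ (parent-data x)) x≢r)

  parent< : ∀ {x} → x ≢ r → depth (parent x) < depth x
  parent< x≢r = ≤-reflexive (sym (parent-depth x≢r))

  <⇒≢ : ∀ {x y} → depth x < depth y → x ≢ y
  <⇒≢ x<y refl = ℕₚ.<-irrefl refl x<y

  -- Climbing through parents avoids every other vertex of the same or larger depth.
  climb : ∀ k {v w} → depth w ≤ k → w ≢ v → depth w ≤ depth v → PathIn G (⊤ - v) w r
  climb k {v} {w} w≤k w≢v w≤v with w ≟ r
  ... | yes refl = here (x∈p∧x≢y⇒x∈p-y ∈⊤ w≢v)
  climb zero w≤0 _ _ | no w≢r = contradiction (depth≡0⇒root (ℕₚ.n≤0⇒n≡0 w≤0)) w≢r
  climb (suc k) w≤k w≢v w≤v | no w≢r =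
    step (x∈p∧x≢y⇒x∈p-y ∈⊤ w≢v) (parent-adj w≢r)
      (climb k (s≤s⁻¹ (≤-trans (parent< w≢r) w≤k)) (<⇒≢ p<v) (ℕₚ.<⇒≤ p<v))
    where p<v = ≤-trans (parent< w≢r) w≤v

  -- Both `a` and `b` climb to the root without meeting `v`, so they are connected in the graph
  -- without `v`.
  shallow-joined : ∀ {v a b} → Adj G v a → Adj G v b → depth a ≤ depth v → depth b ≤ depth v →
                   a ≢ b → Adj G a b
  shallow-joined va vb a≤v b≤v = neighbours-joined blockGraph va vb
    (path-trans G (climb _ ≤-refl (≢-sym (Adj⇒≢ va)) a≤v)
                  (path-sym (climb _ ≤-refl (≢-sym (Adj⇒≢ vb)) b≤v)))

  -- If `a` and `b` differ, they are adjacent. The parent `p` of `a` is then adjacent to `b`, and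
  -- the path from `p` over `b` to `y` avoids `a`, so `p` is adjacent to `y` two levels below it,
  -- which no edge can bridge.
  upper-neighbour-unique : ∀ {y a b} → Adj G y a → Adj G y b →
    depth y ≡ suc (depth a) → depth y ≡ suc (depth b) → a ≡ b
  upper-neighbour-unique {y} {a} {b} ya yb ea eb with a ≟ b
  ... | yes a≡b = a≡b
  ... | no a≢b with a ≟ r
  ...   | yes refl = sym (depth≡0⇒root
                       (trans (ℕₚ.suc-injective (trans (sym eb) ea)) depth-root))
  ...   | no a≢r = contradiction
                     (≤-trans (ℕₚ.≤-reflexive (cong suc (sym (parent-depth a≢r))))
                       (≤-trans (≤-reflexive (sym ea)) (depth-step py))) (ℕₚ.<-irrefl refl)
    where
    p = parent a
    b≡a : depth b ≡ depth a
    b≡a = ℕₚ.suc-injective (trans (sym eb) ea)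
    a<y : depth a < depth y
    a<y = ≤-reflexive (sym ea)
    ab : Adj G a b
    ab = shallow-joined ya yb (ℕₚ.<⇒≤ a<y) (≤-trans (≤-reflexive b≡a) (ℕₚ.<⇒≤ a<y)) a≢b
    pb : Adj G p b
    pb = shallow-joined (parent-adj a≢r) ab (ℕₚ.<⇒≤ (parent< a≢r)) (≤-reflexive b≡a)
           (<⇒≢ (≤-trans (parent< a≢r) (≤-reflexive (sym b≡a))))
    py : Adj G p y
    py = neighbours-joined blockGraph (parent-adj a≢r) (Adj-sym ya)
           (step (x∈p∧x≢y⇒x∈p-y ∈⊤ (<⇒≢ (parent< a≢r))) pb
             (step (x∈p∧x≢y⇒x∈p-y ∈⊤ (≢-sym a≢b)) (Adj-sym yb)
               (here (x∈p∧x≢y⇒x∈p-y ∈⊤ (≢-sym (<⇒≢ a<y))))))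
           (<⇒≢ (ℕₚ.<-trans (parent< a≢r) a<y))

  upper-neighbour⇒parent : ∀ {x y} → Adj G x y → depth x < depth y → y ≢ r × x ≡ parent y
  upper-neighbour⇒parent {x} {y} a x<y =
    y≢r , upper-neighbour-unique (Adj-sym a) (parent-adj y≢r)
            (ℕₚ.≤-antisym (depth-step a) x<y) (parent-depth y≢r)
    where
    y≢r : y ≢ r
    y≢r refl = ℕₚ.n≮0 (≤-trans x<y (≤-reflexive depth-root))

  -- The parent of `x` and the vertex `y` are neighbours of `x` no deeper than `x`, hence adjacent;
  -- uniqueness of the upper neighbour makes that parent the parent of `y` too.
  level-neighbours⇒siblings : ∀ {x y} → Adj G x y → depth x ≡ depth y →
                              x ≢ r × y ≢ r × parent x ≡ parent y
  level-neighbours⇒siblings {x} {y} a e = x≢r , y≢r ,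
    upper-neighbour-unique
      (Adj-sym (shallow-joined (parent-adj x≢r) a (ℕₚ.<⇒≤ (parent< x≢r))
                  (≤-reflexive (sym e))
                  (<⇒≢ (≤-trans (parent< x≢r) (≤-reflexive e)))))
      (parent-adj y≢r) (trans (sym e) (parent-depth x≢r)) (parent-depth y≢r)
    where
    x≢r : x ≢ r
    x≢r refl = Adj⇒≢ a (sym (depth≡0⇒root (trans (sym e) depth-root)))
    y≢r : y ≢ r
    y≢r refl = Adj⇒≢ a (depth≡0⇒root (trans e depth-root))

  rooted : Rooted G r
  rooted = record
    { depth        = depth
    ; bound        = proj₁ (bounded depth)
    ; depth<bound  = proj₂ (bounded depth)
    ; parent       = parent
    ; parent-root  = parent-root
    ; parent-adj   = parent-adj
    ; parent-depth = parent-depth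
    ; edge         = edge
    ; siblings-join = join
    }
    where
    edge : ∀ {x y} → Adj G x y → _
    edge {x} {y} a with ℕₚ.<-cmp (depth x) (depth y)
    ... | tri< x<y _ _ = inj₁ (upper-neighbour⇒parent a x<y)
    ... | tri> _ _ y<x = inj₂ (inj₁ (upper-neighbour⇒parent (Adj-sym a) y<x))
    ... | tri≈ _ e _ with level-neighbours⇒siblings a e
    ...   | x≢r , y≢r , p≡ = inj₂ (inj₂ (siblings x≢r y≢r p≡ a))
    -- All three vertices hang from one parent, and the path from `x` over `y` to `z` avoids it.
    join : ∀ {x y z} → Siblings G r parent x y → Siblings G r parent y z → x ≢ z → Adj G x z
    join {x} {y} {z} xy yz = neighbours-joined blockGraph {parent y}
      (Adj-sym (subst (Adj G x) (same-parent xy) (parent-adj (nonrootˡ xy))))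
      (Adj-sym (subst (Adj G z) (sym (same-parent yz)) (parent-adj (nonrootʳ yz))))
      (step (x∈p∧x≢y⇒x∈p-y ∈⊤ (below x (nonrootˡ xy) (same-parent xy))) (adjacent xy)
        (step (x∈p∧x≢y⇒x∈p-y ∈⊤ (below y (nonrootˡ yz) refl)) (adjacent yz)
          (here (x∈p∧x≢y⇒x∈p-y ∈⊤ (below z (nonrootʳ yz) (sym (same-parent yz)))))))
      where
      below : ∀ w → w ≢ r → parent w ≡ parent y → w ≢ parent y
      below w w≢r e w≡p = <⇒≢ (parent< w≢r) (trans e (sym w≡p))

-- Partitions into maximal cliques

Touching : {V : Set} → Graph V → V → V → Set
Touching G x y = x ≡ y ⊎ Adj G x y

-- The parts are the fibres of `class`, whose values are mere labels. A part is a clique by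
-- `joined`, and a maximal one by `maximal`: whatever touches all of it belongs to it.
record CliqueCover {V : Set} (G : Graph V) : Set where
  field
    class      : V → V
    joined     : ∀ {x y} → class x ≡ class y → Touching G x y
    maximal    : ∀ {z w} → (∀ y → class y ≡ class w → Touching G z y) → class z ≡ class w
    nontrivial : ∀ w → ∃[ v ] (v ≢ w × class v ≡ class w)

vertex : 2 ≤ n → Fin n
vertex (s≤s _) = zero

other : 2 ≤ n → (w : Fin n) → ∃[ v ] v ≢ w
other (s≤s (s≤s _)) zero    = suc zero , λ ()
other (s≤s (s≤s _)) (suc w) = zero , λ ()

allPairs-lookup : {A : Set} {R : A → A → Set} → (∀ {x y} → R x y → R y x) →
                  ∀ {xs x y} → AllPairs R xs → x ∈ₗ xs → y ∈ₗ xs → x ≡ y ⊎ R x y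
allPairs-lookup R-sym _ (Any.here refl) (Any.here refl) = inj₁ refl
allPairs-lookup R-sym (rs AllPairs.∷ _) (Any.here refl) (Any.there y∈) = inj₂ (All.lookup rs y∈)
allPairs-lookup R-sym (rs AllPairs.∷ _) (Any.there x∈) (Any.here refl) = inj₂ (R-sym (All.lookup rs x∈))
allPairs-lookup R-sym (_ AllPairs.∷ ps) (Any.there x∈) (Any.there y∈) = allPairs-lookup R-sym ps x∈ y∈

module BlockCover (G : Graph (Fin n)) (simple : IsSimple G) (2≤n : 2 ≤ n)
                  (connected : Connected G) (blockGraph : IsBlockGraph G) where
  open SimpleGraph G simple

  neighbour : ∀ w → ∃[ u ] Adj G u w
  neighbour w with other 2≤n w
  ... | v , v≢w with connected w v ∈⊤ ∈⊤
  ...   | here _     = contradiction refl v≢w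
  ...   | step _ a _ = _ , Adj-sym a

  -- No part is a singleton: a neighbour of a lone vertex `w` would touch the whole part of `w` and
  -- so belong to it.
  clique-cover : (class : Fin n → Fin n) →
    (∀ {x y} → class x ≡ class y → Touching G x y) →
    (∀ {z w} → (∀ y → class y ≡ class w → Touching G z y) → class z ≡ class w) →
    CliqueCover G
  clique-cover class joined maximal =
    record { class = class ; joined = joined ; maximal = maximal ; nontrivial = nontrivial }
    where
    nontrivial : ∀ w → ∃[ v ] (v ≢ w × class v ≡ class w)
    nontrivial w with any? (λ v → ¬? (v ≟ w) ×-dec (class v ≟ class w))
    ... | yes found = found
    ... | no alone with neighbour w
    ...   | u , uw = u , Adj⇒≢ uw , maximal λ y e → inj₂
              (subst (Adj G u) (sym (decidable-stable (y ≟ w) λ y≢w → alone (y , y≢w , e))) uw)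

  -- The blocks are the fibres over labels that occur. A biconnected set containing a fibre is a
  -- clique, so each of its vertices touches the whole fibre and lies in it.
  cover⇒blockCover : CliqueCover G → HasPerfectBlockCover G
  cover⇒blockCover C =
    map fibre values ,
    Allₚ.map⁺ (All.map isBlock (Allₚ.all-filter used? (allFin n))) ,
    AllPairsₚ.map⁺ (AllPairs.map disjoint (AllPairsₚ.filter⁺ used? (Uniqueₚ.allFin⁺ n))) ,
    λ v → lose (∈-map⁺ fibre (∈-filter⁺ used? (∈-allFin (class v)) (v , refl)))
               (∈-fromDec⁺ (λ x → class x ≟ class v) refl)
    where
    open CliqueCover C
    fibre : Fin n → Subset n
    fibre c = fromDec (λ x → class x ≟ c)
    used? : ∀ c → Dec (∃[ w ] class w ≡ c)
    used? c = any? (λ w → class w ≟ c)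
    values : List (Fin n)
    values = filter used? (allFin n)
    ∈fibre : ∀ c {x} → x ∈ fibre c → class x ≡ c
    ∈fibre c = ∈-fromDec⁻ (λ x → class x ≟ c)

    disjoint : ∀ {c d} → c ≢ d → Disjoint G (fibre c) (fibre d)
    disjoint c≢d v v∈c v∈d = c≢d (trans (sym (∈fibre _ v∈c)) (∈fibre _ v∈d))

    isBlock : ∀ {c} → ∃[ w ] class w ≡ c → IsBlock G (fibre c)
    isBlock {c} (w , refl) = ne , conn , ¬cut , λ T sub neT connT ¬cutT {t} t∈T →
      ∈-fromDec⁺ (λ x → class x ≟ c) (maximal λ y e →
        touching T (biconnected⇒clique G blockGraph (neT , connT , ¬cutT)) t∈T
          (sub (∈-fromDec⁺ (λ x → class x ≟ c) e)))
      where
      touching : ∀ T → IsClique G T → ∀ {x y} → x ∈ T → y ∈ T → Touching G x y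
      touching T clique {x} {y} x∈ y∈ with x ≟ y
      ... | yes x≡y = inj₁ x≡y
      ... | no x≢y  = inj₂ (clique x y x∈ y∈ x≢y)
      fibre-clique : IsClique G (fibre c)
      fibre-clique u v u∈ v∈ u≢v with joined (trans (∈fibre c u∈) (sym (∈fibre c v∈)))
      ... | inj₁ u≡v = contradiction u≡v u≢v
      ... | inj₂ uv  = uv
      bic : Biconnected G (fibre c)
      bic = clique⇒biconnected G (w , ∈-fromDec⁺ (λ x → class x ≟ c) refl) fibre-clique
      ne   = proj₁ bic
      conn = proj₁ (proj₂ bic)
      ¬cut = proj₂ (proj₂ bic)

  -- Each vertex is labelled by the chosen element of its covering block. Disjointness makes equal
  -- labels mean equal blocks.
  blockCover⇒cover : HasPerfectBlockCover G → CliqueCover G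
  blockCover⇒cover (Bs , blocks , disjoint , covering) = clique-cover class joined maximal
    where
    block : Fin n → Subset n
    block v = proj₁ (find (covering v))
    block∈ : ∀ v → block v ∈ₗ Bs
    block∈ v = proj₁ (proj₂ (find (covering v)))
    v∈block : ∀ v → v ∈ block v
    v∈block v = proj₂ (proj₂ (find (covering v)))
    isBlock : ∀ v → IsBlock G (block v)
    isBlock v = All.lookup blocks (block∈ v)

    meeting : ∀ {x y} v → v ∈ block x → v ∈ block y → block x ≡ block y
    meeting {x} {y} v v∈x v∈y
      with allPairs-lookup (λ d v p q → d v q p) disjoint (block∈ x) (block∈ y)
    ... | inj₁ e = e
    ... | inj₂ d = ⊥-elim (d v v∈x v∈y)

    base : Fin n
    base = vertex 2≤n
    class : Fin n → Fin n
    class v = choose base (block v)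
    class≡⇒block≡ : ∀ {x y} → class x ≡ class y → block x ≡ block y
    class≡⇒block≡ {x} {y} e = meeting (class x) (choose∈ base (v∈block x))
      (subst (_∈ block y) (sym e) (choose∈ base (v∈block y)))
    in-block : ∀ {x y} → y ∈ block x → class y ≡ class x
    in-block {x} {y} y∈ = cong (choose base) (meeting y (v∈block y) y∈)

    joined : ∀ {x y} → class x ≡ class y → Touching G x y
    joined {x} {y} e with x ≟ y
    ... | yes x≡y = inj₁ x≡y
    ... | no x≢y  = inj₂ (blockGraph (block x) (isBlock x) x y (v∈block x)
                      (subst (y ∈_) (sym (class≡⇒block≡ e)) (v∈block y)) x≢y)

    -- Adding `z` to the block of `w` gives a clique, which is biconnected, so maximality of the
    -- block absorbs `z`.
    maximal : ∀ {z w} → (∀ y → class y ≡ class w → Touching G z y) → class z ≡ class w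
    maximal {z} {w} touch =
      in-block (proj₂ (proj₂ (proj₂ (isBlock w))) (⁅ z ⁆ ∪ block w) (q⊆p∪q ⁅ z ⁆ (block w))
        (proj₁ bic) (proj₁ (proj₂ bic)) (proj₂ (proj₂ bic)) z∈)
      where
      z∈ : z ∈ ⁅ z ⁆ ∪ block w
      z∈ = p⊆p∪q (block w) (x∈⁅x⁆ z)
      near : ∀ {y} → y ∈ block w → y ≢ z → Adj G z y
      near {y} y∈ y≢z with touch y (in-block y∈)
      ... | inj₁ z≡y = contradiction (sym z≡y) y≢z
      ... | inj₂ zy  = zy
      clique : IsClique G (⁅ z ⁆ ∪ block w)
      clique u v u∈ v∈ u≢v with x∈p∪q⁻ ⁅ z ⁆ _ u∈ | x∈p∪q⁻ ⁅ z ⁆ _ v∈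
      ... | inj₁ u∈z | inj₁ v∈z = contradiction (trans (x∈⁅y⁆⇒x≡y z u∈z) (sym (x∈⁅y⁆⇒x≡y z v∈z))) u≢v
      ... | inj₁ u∈z | inj₂ v∈w with refl ← x∈⁅y⁆⇒x≡y z u∈z = near v∈w (≢-sym u≢v)
      ... | inj₂ u∈w | inj₁ v∈z with refl ← x∈⁅y⁆⇒x≡y z v∈z = Adj-sym (near u∈w u≢v)
      ... | inj₂ u∈w | inj₂ v∈w = blockGraph (block w) (isBlock w) u v u∈w v∈w u≢v
      bic : Biconnected G (⁅ z ⁆ ∪ block w)
      bic = clique⇒biconnected G (z , z∈) clique

-- Children and peers in a rooted graph

module RootedFacts (G : Graph (Fin n)) (simple : IsSimple G) {r : Fin n} (R : Rooted G r) where
  open SimpleGraph G simple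
  open Rooted R

  Child : Fin n → Fin n → Set
  Child x y = y ≢ r × parent y ≡ x

  child? : ∀ x y → Dec (Child x y)
  child? x y = ¬? (y ≟ r) ×-dec (parent y ≟ x)

  child-adj : ∀ {x y} → Child x y → Adj G y x
  child-adj (y≢r , refl) = parent-adj y≢r

  parent≢ : ∀ {x} → x ≢ r → x ≢ parent x
  parent≢ x≢r = Adj⇒≢ (parent-adj x≢r)

  parent≤ : ∀ x → depth (parent x) ≤ depth x
  parent≤ x with x ≟ r
  ... | yes refl = ≤-reflexive (cong depth parent-root)
  ... | no x≢r   = ≤-trans (ℕₚ.n≤1+n _) (≤-reflexive (sym (parent-depth x≢r)))

  shallow≢ : ∀ {x w} → x ≢ r → depth w ≤ depth (parent x) → x ≢ w
  shallow≢ x≢r w≤p refl =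
    ℕₚ.<-irrefl refl (≤-trans (≤-reflexive (sym (parent-depth x≢r))) w≤p)

  grandparent≢ : ∀ {x} → x ≢ r → x ≢ parent (parent x)
  grandparent≢ x≢r = shallow≢ x≢r (parent≤ _)

  -- An equivalence relation. Away from the root, its classes are the blocks with their vertex
  -- nearest to the root removed.
  Peer : Fin n → Fin n → Set
  Peer x y = x ≡ y ⊎ Siblings G r parent x y

  peer? : ∀ x y → Dec (Peer x y)
  peer? x y with x ≟ y | x ≟ r | y ≟ r | parent x ≟ parent y | Adj? G x y
  ... | yes x≡y | _ | _ | _ | _ = yes (inj₁ x≡y)
  ... | no x≢y | yes x≡r | _ | _ | _ = no λ { (inj₁ e) → x≢y e ; (inj₂ s) → nonrootˡ s x≡r }
  ... | no x≢y | no _ | yes y≡r | _ | _ = no λ { (inj₁ e) → x≢y e ; (inj₂ s) → nonrootʳ s y≡r }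
  ... | no x≢y | no _ | no _ | no p≢ | _ = no λ { (inj₁ e) → x≢y e ; (inj₂ s) → p≢ (same-parent s) }
  ... | no x≢y | no _ | no _ | yes _ | no ¬a = no λ { (inj₁ e) → x≢y e ; (inj₂ s) → ¬a (adjacent s) }
  ... | no _ | no x≢r | no y≢r | yes p≡ | yes a = yes (inj₂ (siblings x≢r y≢r p≡ a))

  siblings-sym : ∀ {x y} → Siblings G r parent x y → Siblings G r parent y x
  siblings-sym (siblings x≢r y≢r p≡ a) = siblings y≢r x≢r (sym p≡) (Adj-sym a)

  peer-sym : ∀ {x y} → Peer x y → Peer y x
  peer-sym (inj₁ e) = inj₁ (sym e)
  peer-sym (inj₂ s) = inj₂ (siblings-sym s)

  peer-trans : ∀ {x y z} → Peer x y → Peer y z → Peer x z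
  peer-trans (inj₁ refl) q = q
  peer-trans p (inj₁ refl) = p
  peer-trans {x} {y} {z} (inj₂ s) (inj₂ t) with x ≟ z
  ... | yes x≡z = inj₁ x≡z
  ... | no x≢z  = inj₂ (siblings (nonrootˡ s) (nonrootʳ t)
                    (trans (same-parent s) (same-parent t)) (siblings-join s t x≢z))

  peer⇒touching : ∀ {x y} → Peer x y → Touching G x y
  peer⇒touching (inj₁ e) = inj₁ e
  peer⇒touching (inj₂ s) = inj₂ (adjacent s)

  peer-child : ∀ {v x y} → Peer x y → Child v y → Child v x
  peer-child (inj₁ refl) c = c
  peer-child (inj₂ s) (_ , refl) = nonrootˡ s , same-parent s

-- Excellent graphs

module Greedy (G : Graph (Fin n)) (simple : IsSimple G) {r : Fin n} (R : Rooted G r) where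
  open SimpleGraph G simple
  open Rooted R
  open RootedFacts G simple R

  -- Fuelled recursion for: x is selected iff none of its children is.
  SelectedAt : ℕ → Fin n → Set
  SelectedAt zero    x = Unit.⊤
  SelectedAt (suc k) x = ¬ (∃[ y ] (Child x y × SelectedAt k y))

  selectedAt? : ∀ k x → Dec (SelectedAt k x)
  selectedAt? zero    x = yes Unit.tt
  selectedAt? (suc k) x = ¬? (any? λ y → child? x y ×-dec selectedAt? k y)

  Selected : Fin n → Set
  Selected x = SelectedAt (bound ∸ depth x) x

  selected? : ∀ x → Dec (Selected x)
  selected? x = selectedAt? (bound ∸ depth x) x

  private
    ∸-suc : ∀ {d b} → d < b → b ∸ d ≡ suc (b ∸ suc d)
    ∸-suc {zero}  {suc b} _         = refl
    ∸-suc {suc d} {suc b} (s≤s d<b) = ∸-suc d<b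

    level : ∀ {x} y → Child x y → bound ∸ suc (depth x) ≡ bound ∸ depth y
    level y (y≢r , refl) = cong (bound ∸_) (sym (parent-depth y≢r))

  -- The fuel is positive, as every depth lies below `bound`, and drops by exactly one at a child;
  -- unfolding `SelectedAt` once at `x` thus speaks of `Selected y` itself.
  selected⇒children-not : ∀ {x y} → Selected x → Child x y → ¬ Selected y
  selected⇒children-not {x} {y} sx c sy =
    subst (λ k → SelectedAt k x) (∸-suc (depth<bound x)) sx
      (y , c , subst (λ k → SelectedAt k y) (sym (level y c)) sy)

  unselected⇒child : ∀ {x} → ¬ Selected x → ∃[ y ] (Child x y × Selected y)
  unselected⇒child {x} ¬sx = decidable-stable
    (any? λ y → child? x y ×-dec selected? y) λ none →
      ¬sx (subst (λ k → SelectedAt k x) (sym (∸-suc (depth<bound x))) λ { (y , c , sy) →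
        none (y , c , subst (λ k → SelectedAt k y) (level y c) sy) })

  selectedPeer? : ∀ x z → Dec (Selected z × Peer x z)
  selectedPeer? x z = selected? z ×-dec peer? x z

  -- One selected vertex for each peer class that has any; the default `r` arises only when no peer
  -- of `x` is selected.
  rep : Fin n → Fin n
  rep x = choose r (fromDec (selectedPeer? x))

  rep-spec : ∀ {x} → Selected x → Selected (rep x) × Peer x (rep x)
  rep-spec {x} sx = ∈-fromDec⁻ (selectedPeer? x)
    (choose∈ r (∈-fromDec⁺ (selectedPeer? x) (sx , inj₁ refl)))

  rep-cong : ∀ {x y} → Peer x y → rep x ≡ rep y
  rep-cong {x} {y} xy = cong (choose r) (fromDec-cong (selectedPeer? x) (selectedPeer? y)
    (λ { z (sz , xz) → sz , peer-trans (peer-sym xy) xz })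
    (λ { z (sz , yz) → sz , peer-trans xy yz }))

  leader-data : ∀ x → ∃[ u ] (Selected u × (u ≡ x ⊎ Child x u))
  leader-data x with selected? x
  ... | yes sx = x , sx , inj₁ refl
  ... | no ¬sx with unselected⇒child ¬sx
  ...   | y , c , sy = y , sy , inj₂ c

  leader : Fin n → Fin n
  leader x = proj₁ (leader-data x)

  selected-leader : ∀ x → Selected (leader x)
  selected-leader x = proj₁ (proj₂ (leader-data x))

  -- A part consists of the selected vertices of one peer class, together with their common parent
  -- if its leader was taken among them.
  class : Fin n → Fin n
  class x = rep (leader x)

  -- Equal labels make the leaders peers. Each of `x` and `y` is its leader or the parent of its
  -- leader, and peers are equal or adjacent and have the same parent.
  joined : ∀ {x y} → class x ≡ class y → Touching G x y
  joined {x} {y} e = go (proj₂ (proj₂ (leader-data x))) (proj₂ (proj₂ (leader-data y))) peer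
    where
    peer : Peer (leader x) (leader y)
    peer = peer-trans (subst (Peer (leader x)) e (proj₂ (rep-spec (selected-leader x))))
                      (peer-sym (proj₂ (rep-spec (selected-leader y))))
    go : ∀ {u v} → u ≡ x ⊎ Child x u → v ≡ y ⊎ Child y v → Peer u v → Touching G x y
    go (inj₁ refl) (inj₁ refl) p = peer⇒touching p
    go (inj₁ refl) (inj₂ c)    p = inj₂ (child-adj (peer-child p c))
    go (inj₂ c) (inj₁ refl)    p = inj₂ (Adj-sym (child-adj (peer-child (peer-sym p) c)))
    go (inj₂ c) (inj₂ d)       p = inj₁ (trans (sym (proj₂ c)) (proj₂ (peer-child p d)))

  InI? : ∀ z → Dec (Selected z × rep z ≡ z)
  InI? z = selected? z ×-dec (rep z ≟ z)

  -- One vertex from each part, namely its label: an independent set as large as the number of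
  -- parts.
  I : Subset n
  I = fromDec InI?

  I-independent : Independent G I
  I-independent u v u∈ v∈ uv with ∈-fromDec⁻ InI? u∈ | ∈-fromDec⁻ InI? v∈
  ... | su , ru | sv , rv with edge uv
  ...   | inj₁ (v≢r , e) = selected⇒children-not su (v≢r , sym e) sv
  ...   | inj₂ (inj₁ (u≢r , e)) = selected⇒children-not sv (u≢r , sym e) su
  ...   | inj₂ (inj₂ s) = Adj⇒≢ uv (trans (sym ru) (trans (rep-cong (inj₂ s)) rv))

  class∈I : ∀ x → class x ∈ I
  class∈I x with rep-spec (selected-leader x)
  ... | s , p = ∈-fromDec⁺ InI? (s , sym (rep-cong p))

  independent⇒class-injective : ∀ {S} → Independent G S → ∀ x y → x ∈ S → y ∈ S →
                                class x ≡ class y → x ≡ y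
  independent⇒class-injective ind x y x∈ y∈ e with joined e
  ... | inj₁ x≡y = x≡y
  ... | inj₂ xy  = contradiction xy (ind x y x∈ y∈)

  -- If `S` missed the part of `w`, then `class` would inject `S` into `I` without the label of that
  -- part, making `S` smaller than the independent set `I`.
  maximum-meets : ∀ {S} → MaximumIndependent G S → ∀ w → ∃[ s ] (s ∈ S × class s ≡ class w)
  maximum-meets {S} (ind , max) w = decidable-stable
    (any? λ s → (s ∈? S) ×-dec (class s ≟ class w)) λ missed →
      ℕₚ.<-irrefl refl (≤-trans (x∈p⇒∣p-x∣<∣p∣ (class∈I w)) (≤-trans (max I I-independent)
        (∣∣-injection S (I - class w) class
          (λ x x∈ → x∈p∧x≢y⇒x∈p-y (class∈I x) λ e → missed (x , x∈ , e))
          (independent⇒class-injective ind))))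

  -- A maximum independent set through `z` meets the part of `w` in some `s`. As `z` touches `s` and
  -- both lie in an independent set, `s` is `z`.
  maximal : AlphaExcellent G → ∀ {z w} →
            (∀ y → class y ≡ class w → Touching G z y) → class z ≡ class w
  maximal excellent {z} {w} touch with excellent z
  ... | S , maxS , z∈S with maximum-meets maxS w
  ...   | s , s∈S , e with touch s e
  ...     | inj₁ refl = e
  ...     | inj₂ zs   = contradiction zs (proj₁ maxS z s z∈S s∈S)

-- Clique covers of a rooted graph, and excellence of covered graphs

module CoverStructure (G : Graph (Fin n)) (simple : IsSimple G) {r : Fin n} (R : Rooted G r)
                      (C : CliqueCover G) where
  open SimpleGraph G simple
  open Rooted R
  open RootedFacts G simple R
  open CliqueCover C

  -- The vertices of a part other than the one nearest to the root.
  Low : Fin n → Set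
  Low x = x ≢ r × class (parent x) ≡ class x

  low? : ∀ x → Dec (Low x)
  low? x = ¬? (x ≟ r) ×-dec (class (parent x) ≟ class x)

  -- The common parent of two siblings in a part touches the whole part, so maximality puts it
  -- there.
  siblings⇒low : ∀ {x y} → class y ≡ class x → Siblings G r parent y x → Low x
  siblings⇒low {x} {y} yx s = nonrootʳ s , maximal touch
    where
    touch : ∀ w → class w ≡ class x → Touching G (parent x) w
    touch w e with joined e
    ... | inj₁ refl = inj₂ (Adj-sym (parent-adj (nonrootʳ s)))
    ... | inj₂ wx with edge wx
    ...   | inj₁ (_ , w≡p) = inj₁ (sym w≡p)
    ...   | inj₂ (inj₂ t) = inj₂ (Adj-sym (subst (Adj G w) (same-parent t) (parent-adj (nonrootˡ t))))
    -- Here `w` is a child of `x`; being in the part it must also touch `y`, a sibling of `x`, and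
    -- no kind of edge permits this.
    ...   | inj₂ (inj₁ (w≢r , refl)) with joined (trans e (sym yx))
    ...     | inj₁ refl = contradiction (same-parent s) (parent≢ (nonrootʳ s))
    ...     | inj₂ wy with edge wy
    ...       | inj₁ (_ , w≡py) = contradiction (trans w≡py (same-parent s)) (grandparent≢ w≢r)
    ...       | inj₂ (inj₁ (_ , y≡x)) = contradiction y≡x (Adj⇒≢ (adjacent s))
    ...       | inj₂ (inj₂ t) = contradiction (trans (same-parent t) (same-parent s))
                                  (parent≢ (nonrootʳ s))

  top⇒child : ∀ {x y} → ¬ Low x → class y ≡ class x → y ≢ x → y ≢ r × parent y ≡ x
  top⇒child {x} ¬low e y≢x with joined e
  ... | inj₁ y≡x = contradiction y≡x y≢x
  ... | inj₂ yx with edge yx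
  ...   | inj₁ (x≢r , refl)    = contradiction (x≢r , e) ¬low
  ...   | inj₂ (inj₁ (y≢r , p)) = y≢r , sym p
  ...   | inj₂ (inj₂ s)        = contradiction (siblings⇒low e s) ¬low

  -- The part of a low `x` contains `x` and its parent. A child of `x` cannot touch that parent, so
  -- the part has only the parent and siblings of `x` besides `x`, all touched by `z`.
  low-siblings : ∀ {x z} → Low x → Siblings G r parent x z → class z ≡ class x
  low-siblings {x} {z} (x≢r , e) s = maximal touch
    where
    touch : ∀ y → class y ≡ class x → Touching G z y
    touch y yx with z ≟ y | joined yx | joined (trans yx (sym e))
    ... | yes z≡y | _ | _ = inj₁ z≡y
    ... | no _ | inj₁ refl | _ = inj₂ (Adj-sym (adjacent s))
    ... | no _ | inj₂ _ | inj₁ refl =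
          inj₂ (subst (Adj G z) (sym (same-parent s)) (parent-adj (nonrootʳ s)))
    ... | no z≢y | inj₂ a | inj₂ b with edge a
    ...   | inj₁ (_ , y≡p) = contradiction y≡p (Adj⇒≢ b)
    ...   | inj₂ (inj₂ t) = inj₂ (Adj-sym (siblings-join t s (≢-sym z≢y)))
    ...   | inj₂ (inj₁ (y≢r , refl)) with edge b
    ...     | inj₁ (_ , y≡pp) = contradiction y≡pp
                (shallow≢ y≢r (≤-trans (parent≤ _) (parent≤ _)))
    ...     | inj₂ (inj₁ (_ , px≡x)) = contradiction (sym px≡x) (parent≢ x≢r)
    ...     | inj₂ (inj₂ t) = contradiction (same-parent t) (grandparent≢ x≢r)

  -- The set takes `r` from its own part and a low vertex from every other part. It is maximum
  -- because an independent set has at most one vertex in each part.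
  root-in-maximum : ∃[ S ] (MaximumIndependent G S × r ∈ S)
  root-in-maximum = S , (S-independent , S-maximum) , ∈-fromDec⁺ chosen? (sym (pick-root refl))
    where
    low-in? : ∀ c z → Dec (class z ≡ c × Low z)
    low-in? c z = (class z ≟ c) ×-dec low? z

    pick-data : ∀ c → ∃[ z ] ((c ≡ class r → z ≡ r) ×
                  (∀ y → class y ≡ c → class z ≡ c × (z ≡ r ⊎ Low z)))
    pick-data c with c ≟ class r
    ... | yes c≡r = r , (λ _ → refl) , λ _ _ → sym c≡r , inj₁ refl
    ... | no c≢r with any? (low-in? c)
    ...   | yes (z , e , low) = z , (λ c≡r → contradiction c≡r c≢r) , λ _ _ → e , inj₂ low
    -- Such a label names no part, so `r` is only a default: a part contains a second vertex besides
    -- a non-low one, and this is a child of it and hence low.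
    ...   | no none = r , (λ _ → refl) , λ y y≡c → ⊥-elim (absurd y y≡c)
      where
      absurd : ∀ y → class y ≡ c → ⊥
      absurd y refl with low? y | nontrivial y
      ... | yes low | _ = none (y , refl , low)
      ... | no ¬low | v , v≢y , e with top⇒child ¬low e v≢y
      ...   | v≢r , refl = none (v , e , v≢r , sym e)

    pick : Fin n → Fin n
    pick c = proj₁ (pick-data c)
    pick-root : ∀ {c} → c ≡ class r → pick c ≡ r
    pick-root {c} = proj₁ (proj₂ (pick-data c))
    class-pick : ∀ x → class (pick (class x)) ≡ class x
    class-pick x = proj₁ (proj₂ (proj₂ (pick-data (class x))) x refl)
    low-pick : ∀ x → pick (class x) ≡ r ⊎ Low (pick (class x))
    low-pick x = proj₂ (proj₂ (proj₂ (pick-data (class x))) x refl)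

    chosen? : ∀ x → Dec (x ≡ pick (class x))
    chosen? x = x ≟ pick (class x)
    S : Subset n
    S = fromDec chosen?

    chosen-low : ∀ {x} → x ∈ S → x ≢ r → class (parent x) ≡ class x
    chosen-low {x} x∈ x≢r with ∈-fromDec⁻ chosen? x∈ | low-pick x
    ... | x≡ | inj₁ e = contradiction (trans x≡ e) x≢r
    ... | x≡ | inj₂ low = proj₂ (subst Low (sym x≡) low)

    class-injective : ∀ {x y} → x ∈ S → y ∈ S → class x ≡ class y → x ≡ y
    class-injective x∈ y∈ e =
      trans (∈-fromDec⁻ chosen? x∈) (trans (cong pick e) (sym (∈-fromDec⁻ chosen? y∈)))

    S-independent : Independent G S
    S-independent u v u∈ v∈ uv = Adj⇒≢ uv (class-injective u∈ v∈ same)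
      where
      -- A chosen vertex other than the root shares its part with its parent, so every kind of edge
      -- would put both ends in one part.
      same : class u ≡ class v
      same with edge uv
      ... | inj₁ (v≢r , refl) = chosen-low v∈ v≢r
      ... | inj₂ (inj₁ (u≢r , refl)) = sym (chosen-low u∈ u≢r)
      ... | inj₂ (inj₂ s) = trans (sym (chosen-low u∈ (nonrootˡ s)))
                              (trans (cong class (same-parent s)) (chosen-low v∈ (nonrootʳ s)))

    S-maximum : ∀ T → Independent G T → ∣ T ∣ ≤ ∣ S ∣
    S-maximum T indT = ∣∣-injection T S (λ x → pick (class x))
      (λ x _ → ∈-fromDec⁺ chosen? (cong pick (sym (class-pick x))))
      inj
      where
      inj : ∀ x y → x ∈ T → y ∈ T → pick (class x) ≡ pick (class y) → x ≡ y
      inj x y x∈ y∈ e with joined (trans (sym (class-pick x)) (trans (cong class e) (class-pick y)))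
      ... | inj₁ x≡y = x≡y
      ... | inj₂ xy  = contradiction xy (indT x y x∈ y∈)

-- From the family to covers

bool-ext : ∀ {a b : Bool} → (a ≡ true → b ≡ true) → (b ≡ true → a ≡ true) → a ≡ b
bool-ext {true}          f g = sym (f refl)
bool-ext {false} {true}  f g = g refl
bool-ext {false} {false} f g = refl

eqF-refl : ∀ {m} (i : Fin m) → eqF i i ≡ true
eqF-refl i with i ≟ i
... | yes _  = refl
... | no i≢i = contradiction refl i≢i

eqF⇒≡ : ∀ {m} {i j : Fin m} → eqF i j ≡ true → i ≡ j
eqF⇒≡ {i = i} {j} e with i ≟ j
... | yes i≡j = i≡j

eqF-≢ : ∀ {m} {i j : Fin m} → i ≢ j → eqF i j ≡ false
eqF-≢ i≢j = Boolₚ.¬-not (λ e → i≢j (eqF⇒≡ e))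

toℕ-≡ᵇ-refl : ∀ {m} (a : Fin m) → (toℕ a ≡ᵇ toℕ a) ≡ true
toℕ-≡ᵇ-refl zero    = refl
toℕ-≡ᵇ-refl (suc a) = toℕ-≡ᵇ-refl a

toℕ-≡ᵇ⇒≡ : ∀ {m} (a b : Fin m) → (toℕ a ≡ᵇ toℕ b) ≡ true → a ≡ b
toℕ-≡ᵇ⇒≡ zero    zero    _ = refl
toℕ-≡ᵇ⇒≡ (suc a) (suc b) e = cong suc (toℕ-≡ᵇ⇒≡ a b e)

clique-leaves : ∀ {m l} {i j : Fin m} (a b : Fin l) → i ≡ j → a ≢ b →
                eqF i j ∧ not (toℕ a ≡ᵇ toℕ b) ≡ true
clique-leaves {i = i} a b refl a≢b =
  cong₂ _∧_ (eqF-refl i) (cong not (Boolₚ.¬-not λ e → a≢b (toℕ-≡ᵇ⇒≡ a b e)))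

complete-cover : (G : Graph (Fin n)) → 2 ≤ n → (∀ i j → adj G i j ≡ not (eqF i j)) → CliqueCover G
complete-cover G 2≤n adj≡ = record
  { class = λ _ → vertex 2≤n
  ; joined = joined
  ; maximal = λ _ → refl
  ; nontrivial = λ w → proj₁ (other 2≤n w) , proj₂ (other 2≤n w) , refl
  }
  where
  joined : ∀ {x y} → _ → Touching G x y
  joined {x} {y} _ with x ≟ y
  ... | yes x≡y = inj₁ x≡y
  ... | no x≢y  = inj₂ (trans (adj≡ x y) (cong not (eqF-≢ x≢y)))

iso-cover : {W : Set} {G : Graph (Fin n)} {H : Graph W} → Iso G H → CliqueCover H → CliqueCover G
iso-cover {G = G} {H} (f , iso) C = record
  { class = λ x → from (class (to x))
  ; joined = λ e → pull (joined (from-injective e))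
  ; maximal = λ {z} {w} touch → cong from (maximal λ y e → subst (Touching H (to z)) (to-from y)
      (push (touch (from y) (cong from (trans (cong class (to-from y)) e)))))
  ; nontrivial = λ w → nontrivial-from (nontrivial (to w))
  }
  where
  open CliqueCover C
  open Inverse f using (to; from; strictlyInverseˡ; strictlyInverseʳ)
  to-from = strictlyInverseˡ
  from-injective : ∀ {a b} → from a ≡ from b → a ≡ b
  from-injective {a} {b} e = trans (sym (to-from a)) (trans (cong to e) (to-from b))
  to-injective : ∀ {x y} → to x ≡ to y → x ≡ y
  to-injective {x} {y} e = trans (sym (strictlyInverseʳ x)) (trans (cong from e) (strictlyInverseʳ y))
  pull : ∀ {x y} → Touching H (to x) (to y) → Touching G x y
  pull (inj₁ e) = inj₁ (to-injective e)
  pull (inj₂ a) = inj₂ (trans (iso _ _) a)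
  push : ∀ {x y} → Touching G x y → Touching H (to x) (to y)
  push (inj₁ e) = inj₁ (cong to e)
  push (inj₂ a) = inj₂ (trans (sym (iso _ _)) a)
  nontrivial-from : ∀ {w} → ∃[ v ] (v ≢ to w × class v ≡ class (to w)) →
                    ∃[ v ] (v ≢ w × from (class (to v)) ≡ from (class (to w)))
  nontrivial-from (v , v≢ , e) = from v ,
    (λ from-v≡w → v≢ (trans (sym (to-from v)) (cong to from-v≡w))) ,
    cong from (trans (cong class (to-from v)) e)

-- Old parts are kept, and each body vertex forms a new part with its leaf clique. A body vertex
-- cannot join an old part, since it touches only `v` there and the part has at least two vertices.
attach-cover : ∀ {m} {G : Graph (Fin m)} → CliqueCover G → ∀ v k h → CliqueCover (attach G v k h)
attach-cover {m} {G} C v k h = record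
  { class = class′
  ; joined = λ {x} {y} → joined′ x y
  ; maximal = λ {z} {w} → maximal′ z w
  ; nontrivial = nontrivial′
  }
  where
  open CliqueCover C
  H = attach G v k h

  pattern body i   = inj₂ (inj₁ i)
  pattern leaf i a = inj₂ (inj₂ (i , a))

  class′ : Fin m ⊎ CoronaV k h → Fin m ⊎ CoronaV k h
  class′ (inj₁ x)   = inj₁ (class x)
  class′ (body i)   = body i
  class′ (leaf i a) = body i

  joined′ : ∀ x y → class′ x ≡ class′ y → Touching H x y
  joined′ (inj₁ x) (inj₁ y) e with joined (Sumₚ.inj₁-injective e)
  ... | inj₁ refl = inj₁ refl
  ... | inj₂ a    = inj₂ a
  joined′ (inj₁ x) (body i)   ()
  joined′ (inj₁ x) (leaf i a) ()
  joined′ (body i)   (inj₁ y) ()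
  joined′ (leaf i a) (inj₁ y) ()
  joined′ (body i) (body .i)     refl = inj₁ refl
  joined′ (body i) (leaf .i a)   refl = inj₂ (eqF-refl i)
  joined′ (leaf i a) (body .i)   refl = inj₂ (eqF-refl i)
  joined′ (leaf i a) (leaf .i b) refl with a ≟ b
  ... | yes refl = inj₁ refl
  ... | no a≢b   = inj₂ (clique-leaves {i = i} a b refl a≢b)

  inner : ∀ {x y} → Touching H (inj₁ x) (inj₁ y) → Touching G x y
  inner (inj₁ e) = inj₁ (Sumₚ.inj₁-injective e)
  inner (inj₂ a) = inj₂ a

  body-touches : ∀ {i x} → Touching H (body i) (inj₁ x) → x ≡ v
  body-touches (inj₂ a) = eqF⇒≡ a

  -- Two vertices pin down a new part: old vertices and other body vertices miss its leaf, and
  -- leaves elsewhere miss its body vertex.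
  corona-maximal : ∀ z j → Touching H z (body j) → Touching H z (leaf j zero) → class′ z ≡ body j
  corona-maximal (inj₁ x)   j _        (inj₁ ())
  corona-maximal (inj₁ x)   j _        (inj₂ ())
  corona-maximal (body i)   j _        (inj₂ a) = cong body (eqF⇒≡ a)
  corona-maximal (leaf i b) j (inj₂ a) _        = cong body (eqF⇒≡ a)

  maximal′ : ∀ z w → (∀ y → class′ y ≡ class′ w → Touching H z y) → class′ z ≡ class′ w
  maximal′ (inj₁ z) (inj₁ w) touch =
    cong inj₁ (maximal λ y e → inner (touch (inj₁ y) (cong inj₁ e)))
  maximal′ (body i) (inj₁ w) touch with nontrivial w
  ... | u , u≢w , e = contradiction
        (trans (body-touches (touch (inj₁ u) (cong inj₁ e))) (sym (body-touches (touch (inj₁ w) refl)))) u≢w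
  maximal′ (leaf i a) (inj₁ w) touch with touch (inj₁ w) refl
  ... | inj₁ ()
  ... | inj₂ ()
  maximal′ z (body j)   touch = corona-maximal z j (touch (body j) refl) (touch (leaf j zero) refl)
  maximal′ z (leaf j _) touch = corona-maximal z j (touch (body j) refl) (touch (leaf j zero) refl)

  nontrivial′ : ∀ w → ∃[ u ] (u ≢ w × class′ u ≡ class′ w)
  nontrivial′ (inj₁ w) with nontrivial w
  ... | u , u≢w , e = inj₁ u , (λ e′ → u≢w (Sumₚ.inj₁-injective e′)) , cong inj₁ e
  nontrivial′ (body i)   = leaf i zero , (λ ()) , refl
  nontrivial′ (leaf i a) = body i , (λ ()) , refl

inF⇒cover : {G : Graph (Fin n)} → InF G → CliqueCover G
inF⇒cover (complete G 2≤n adj≡) = complete-cover G 2≤n adj≡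
inF⇒cover (extend G′∈F v k h G iso) = iso-cover iso (attach-cover (inF⇒cover G′∈F) v k h)

-- From covers to the family

-- A bijection onto the vertices satisfying `P`, stated without a subtype. `A` is arbitrary so that
-- the vertices of an attached corona can serve as indices.
record Enumerates {A : Set} (P : Fin n → Set) (e : A → Fin n) : Set where
  field
    injective : ∀ {a b} → e a ≡ e b → a ≡ b
    sound     : ∀ a → P (e a)
    covering  : ∀ {x} → P x → ∃[ a ] e a ≡ x

  index : ∀ {x} → P x → A
  index px = proj₁ (covering px)

  index-spec : ∀ {x} (px : P x) → e (index px) ≡ x
  index-spec px = proj₂ (covering px)

open Enumerates

Enumeration : (Fin n → Set) → ℕ → Set
Enumeration {n} P k = Σ (Fin k → Fin n) (Enumerates P)

enumerate : ∀ {n} {P : Fin n → Set} → (∀ x → Dec (P x)) → ∃ (Enumeration P)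
enumerate {zero} P? = 0 , (λ ()) ,
  record { injective = λ { {()} } ; sound = λ () ; covering  = λ { {()} } }
enumerate {suc n} {P} P? with P? zero | enumerate (λ x → P? (suc x))
... | yes p₀ | k , e , E = suc k , e′ , record { injective = inj ; sound = snd ; covering  = cmp }
  where
  e′ : Fin (suc k) → Fin (suc n)
  e′ zero    = zero
  e′ (suc a) = suc (e a)
  inj : ∀ {a b} → e′ a ≡ e′ b → a ≡ b
  inj {zero}  {zero}  _  = refl
  inj {suc a} {suc b} eq = cong suc (injective E (suc-injective eq))
  snd : ∀ a → P (e′ a)
  snd zero    = p₀
  snd (suc a) = sound E a
  cmp : ∀ {x} → P x → ∃[ a ] e′ a ≡ x
  cmp {zero}  _  = zero , refl
  cmp {suc x} px with covering E px
  ... | a , eq = suc a , cong suc eq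
... | no ¬p₀ | k , e , E = k , (λ a → suc (e a)) , record
  { injective = λ eq → injective E (suc-injective eq)
  ; sound     = sound E
  ; covering  = λ { {zero} p₀ → contradiction p₀ ¬p₀
                  ; {suc x} px → proj₁ (covering E px) , cong suc (proj₂ (covering E px)) }
  }

-- Bodies and leaf cliques have orders encoded as successors, so nonempty sets need their size in
-- that form.
enumerate⁺ : {P : Fin n → Set} → (∀ x → Dec (P x)) → ∃ P → ∃[ k ] Enumeration P (suc k)
enumerate⁺ P? (x , px) with enumerate P?
... | suc k , E     = k , E
... | zero  , e , E with () ← index E px

-- For an enumeration `e` of `S`, this is the subgraph induced on `S` with its vertices renumbered.
pull : {A B : Set} → Graph B → (A → B) → Graph A
adj (pull G e) x y = adj G (e x) (e y)

enumerations-iso : ∀ {m} {A : Set} {P : Fin n → Set} {G : Graph (Fin n)} {H : Graph A}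
  {e : Fin m → Fin n} {g : A → Fin n} → Enumerates P e → Enumerates P g →
  (∀ a b → adj G (g a) (g b) ≡ adj H a b) → Iso (pull G e) H
enumerations-iso {G = G} {H} {e} {g} E F same = mk↔ₛ′ to from to-from from-to ,
  λ x y → trans (cong₂ (adj G) (sym (index-spec F (sound E x))) (sym (index-spec F (sound E y))))
                (same (to x) (to y))
  where
  to = λ a → index F (sound E a)
  from = λ b → index E (sound F b)
  to-from : ∀ b → to (from b) ≡ b
  to-from b = injective F (trans (index-spec F (sound E (from b))) (index-spec E (sound F b)))
  from-to : ∀ a → from (to a) ≡ a
  from-to a = injective E (trans (index-spec E (sound F (to a))) (index-spec F (sound E a)))

two-elements : ∀ {m} {i j : Fin m} → i ≢ j → 2 ≤ m
two-elements {suc zero} {zero} {zero} i≢j = contradiction refl i≢j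
two-elements {suc (suc m)} _ = s≤s (s≤s z≤n)

module Build (G : Graph (Fin n)) (simple : IsSimple G) {r : Fin n} (R : Rooted G r)
             (C : CliqueCover G) where
  open SimpleGraph G simple
  open Rooted R
  open CliqueCover C
  open RootedFacts G simple R
  open CoverStructure G simple R C

  -- The invariant of the growing vertex set. Under these closures, an edge leaving `S` can only run
  -- from a vertex of `S` down to a child.
  record Saturated (S : Subset n) : Set where
    field
      root∈     : r ∈ S
      parent∈   : ∀ {x} → x ∈ S → parent x ∈ S
      siblings∈ : ∀ {x y} → x ∈ S → Siblings G r parent x y → y ∈ S
      class∈    : ∀ {x y} → x ∈ S → class y ≡ class x → y ∈ S

  -- Quantifying over all numberings frees the induction from any fixed one; at the end the identity
  -- numbering gives `G` itself.
  Represented : Subset n → Set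
  Represented S = ∀ {m} {e : Fin m → Fin n} → Enumerates (_∈ S) e → InF (pull G e)

  same-class-adj : ∀ {x y} → class x ≡ class y → x ≢ y → Adj G x y
  same-class-adj e x≢y with joined e
  ... | inj₁ x≡y = contradiction x≡y x≢y
  ... | inj₂ xy  = xy

  adj≡not-eqF : ∀ {m} {e : Fin m → Fin n} {i j} → (e i ≢ e j → Adj G (e i) (e j)) →
                (∀ {a b} → e a ≡ e b → a ≡ b) → adj G (e i) (e j) ≡ not (eqF i j)
  adj≡not-eqF {e = e} {i} {j} a inj with i ≟ j
  ... | yes refl = proj₂ simple (e i)
  ... | no i≢j   = a (λ eq → i≢j (inj eq))

  rootClass? : ∀ x → Dec (class x ≡ class r)
  rootClass? x = class x ≟ class r

  root-represented : Represented (fromDec rootClass?)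
  root-represented {e = e} E with nontrivial r
  ... | u , u≢r , u~r = complete _
          (two-elements λ i≡j → u≢r (trans (sym (index-spec E u∈))
             (trans (cong e i≡j) (index-spec E r∈))))
          λ i j → adj≡not-eqF {e = e} (same-class-adj (trans (member i) (sym (member j)))) (injective E)
    where
    u∈ = ∈-fromDec⁺ rootClass? u~r
    r∈ = ∈-fromDec⁺ rootClass? refl
    member : ∀ i → class (e i) ≡ class r
    member i = ∈-fromDec⁻ rootClass? (sound E i)

  -- The root is not low, so the rest of its part consists of children of `r`. These are low, and
  -- `low-siblings` gives closure under siblings.
  root-saturated : Saturated (fromDec rootClass?)
  root-saturated = record
    { root∈     = ∈-fromDec⁺ rootClass? refl
    ; parent∈   = λ x∈ → ∈-fromDec⁺ rootClass? (up (∈-fromDec⁻ rootClass? x∈))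
    ; siblings∈ = λ x∈ s → ∈-fromDec⁺ rootClass? (across (∈-fromDec⁻ rootClass? x∈) s)
    ; class∈    = λ x∈ e → ∈-fromDec⁺ rootClass? (trans e (∈-fromDec⁻ rootClass? x∈))
    }
    where
    child : ∀ {x} → class x ≡ class r → x ≢ r → x ≢ r × parent x ≡ r
    child = top⇒child (λ low → proj₁ low refl)
    up : ∀ {x} → class x ≡ class r → class (parent x) ≡ class r
    up {x} e with x ≟ r
    ... | yes refl = cong class parent-root
    ... | no x≢r   = cong class (proj₂ (child e x≢r))
    across : ∀ {x y} → class x ≡ class r → Siblings G r parent x y → class y ≡ class r
    across e s = trans (low-siblings
      (nonrootˡ s , trans (up e) (sym e)) s) e

  module Step {S : Subset n} (sat : Saturated S) (rep : Represented S)
              {z : Fin n} (z∉S : z ∉ S) (pz∈S : parent z ∈ S) where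
    open Saturated sat

    Body : Fin n → Set
    Body = Peer z

    -- For a body vertex `x`, the top of its part, these are all the other vertices of the part.
    Leaf : Fin n → Fin n → Set
    Leaf x y = parent y ≡ x × class y ≡ class x

    leaf? : ∀ x y → Dec (Leaf x y)
    leaf? x y = (parent y ≟ x) ×-dec (class y ≟ class x)

    body∉S : ∀ {x} → Body x → x ∉ S
    body∉S (inj₁ refl) x∈S = z∉S x∈S
    body∉S (inj₂ s)    x∈S = z∉S (siblings∈ x∈S (siblings-sym s))

    body-parent : ∀ {x} → Body x → parent x ≡ parent z
    body-parent (inj₁ refl) = refl
    body-parent (inj₂ s)    = sym (same-parent s)

    body-parent∈S : ∀ {x} → Body x → parent x ∈ S
    body-parent∈S b = subst (_∈ S) (sym (body-parent b)) pz∈S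

    ∉S⇒nonroot : ∀ {x} → x ∉ S → x ≢ r
    ∉S⇒nonroot x∉S refl = x∉S root∈

    -- Otherwise `x` would share its part with its parent, which lies in `S`, and closure under
    -- parts would bring `x` into `S`.
    body-top : ∀ {x} → Body x → ¬ Low x
    body-top b (_ , e) = body∉S b (class∈ (body-parent∈S b) (sym e))

    leaf∉S : ∀ {x y} → Body x → Leaf x y → y ∉ S
    leaf∉S b (_ , e) y∈S = body∉S b (class∈ y∈S (sym e))

    leaf≢body : ∀ {x y x′} → Body x → Leaf x y → Body x′ → x′ ≢ y
    leaf≢body b (refl , _) b′ refl = body∉S b (body-parent∈S b′)

    old-body-adj : ∀ {s x} → s ∈ S → Body x → Adj G s x → s ≡ parent z
    old-body-adj s∈ b a with edge a
    ... | inj₁ (_ , s≡p)        = trans s≡p (body-parent b)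
    ... | inj₂ (inj₁ (_ , x≡p)) = contradiction (subst (_∈ S) (sym x≡p) (parent∈ s∈)) (body∉S b)
    ... | inj₂ (inj₂ t)         = contradiction (siblings∈ s∈ t) (body∉S b)

    old-leaf-adj : ∀ {s x y} → s ∈ S → Body x → Leaf x y → ¬ Adj G s y
    old-leaf-adj s∈ b l a with edge a
    ... | inj₁ (_ , s≡p)        = body∉S b (subst (_∈ S) (trans s≡p (proj₁ l)) s∈)
    ... | inj₂ (inj₁ (_ , y≡p)) = leaf∉S b l (subst (_∈ S) (sym y≡p) (parent∈ s∈))
    ... | inj₂ (inj₂ t)         = leaf∉S b l (siblings∈ s∈ t)

    body-body-adj : ∀ {x x′} → Body x → Body x′ → x ≢ x′ → Adj G x x′
    body-body-adj b b′ x≢x′ with peer⇒touching (peer-trans (peer-sym b) b′)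
    ... | inj₁ x≡x′ = contradiction x≡x′ x≢x′
    ... | inj₂ a    = a

    body-leaf-adj : ∀ {x x′ y} → Body x → Body x′ → Leaf x′ y → Adj G x y → x ≡ x′
    body-leaf-adj b b′ l a with edge a
    ... | inj₁ (_ , x≡p) = trans x≡p (proj₁ l)
    ... | inj₂ (inj₁ (_ , y≡p)) =
          contradiction (subst (_∈ S) (sym y≡p) (body-parent∈S b)) (leaf∉S b′ l)
    ... | inj₂ (inj₂ t) = contradiction refl (leaf≢body b′ l (peer-trans b (inj₂ t)))

    leaf-body-adj : ∀ {x y} → Body x → Leaf x y → Adj G x y
    leaf-body-adj b l@(refl , _) = Adj-sym (parent-adj (∉S⇒nonroot (leaf∉S b l)))

    leaf-leaf-adj : ∀ {x y x′ y′} → Body x → Leaf x y → Body x′ → Leaf x′ y′ → Adj G y y′ → x ≡ x′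
    leaf-leaf-adj b l b′ l′ a with edge a
    ... | inj₁ (_ , y≡p) = contradiction (sym (trans y≡p (proj₁ l′))) (leaf≢body b l b′)
    ... | inj₂ (inj₁ (_ , y′≡p)) = contradiction (sym (trans y′≡p (proj₁ l))) (leaf≢body b′ l′ b)
    ... | inj₂ (inj₂ t) = trans (sym (proj₁ l)) (trans (same-parent t) (proj₁ l′))

    -- The body vertex belonging to a leaf is recovered as its parent, so no existential has to be
    -- decided.
    New : Fin n → Set
    New y = y ∈ S ⊎ Body y ⊎ (Body (parent y) × Leaf (parent y) y)

    new? : ∀ y → Dec (New y)
    new? y = (y ∈? S) ⊎-dec (peer? z y ⊎-dec (peer? z (parent y) ×-dec leaf? (parent y) y))

    S⁺ : Subset n
    S⁺ = fromDec new?

    body-class : ∀ {x y} → Body x → class y ≡ class x → New y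
    body-class {x} {y} b e with y ≟ x
    ... | yes refl = inj₂ (inj₁ b)
    ... | no y≢x with top⇒child (body-top b) e y≢x
    ...   | _ , refl = inj₂ (inj₂ (b , refl , e))

    new-parent : ∀ {x} → New x → New (parent x)
    new-parent (inj₁ x∈)             = inj₁ (parent∈ x∈)
    new-parent (inj₂ (inj₁ b))       = inj₁ (body-parent∈S b)
    new-parent (inj₂ (inj₂ (b , _))) = inj₂ (inj₁ b)

    new-siblings : ∀ {x y} → New x → Siblings G r parent x y → New y
    new-siblings (inj₁ x∈)       t = inj₁ (siblings∈ x∈ t)
    new-siblings (inj₂ (inj₁ b)) t = inj₂ (inj₁ (peer-trans b (inj₂ t)))
    -- A leaf is low, so its siblings lie in the same part.
    new-siblings (inj₂ (inj₂ (b , _ , e))) t =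
      body-class b (trans (low-siblings (nonrootˡ t , sym e) t) e)

    new-class : ∀ {x y} → New x → class y ≡ class x → New y
    new-class (inj₁ x∈)               e = inj₁ (class∈ x∈ e)
    new-class (inj₂ (inj₁ b))         e = body-class b e
    new-class (inj₂ (inj₂ (b , _ , f))) e = body-class b (trans e f)

    saturated⁺ : Saturated S⁺
    saturated⁺ = record
      { root∈     = ∈-fromDec⁺ new? (inj₁ root∈)
      ; parent∈   = λ x∈ → ∈-fromDec⁺ new? (new-parent (∈-fromDec⁻ new? x∈))
      ; siblings∈ = λ x∈ s → ∈-fromDec⁺ new? (new-siblings (∈-fromDec⁻ new? x∈) s)
      ; class∈    = λ x∈ e → ∈-fromDec⁺ new? (new-class (∈-fromDec⁻ new? x∈) e)
      }

    ∣S∣<∣S⁺∣ : ∣ S ∣ < ∣ S⁺ ∣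
    ∣S∣<∣S⁺∣ = p⊂q⇒∣p∣<∣q∣
      ((λ x∈ → ∈-fromDec⁺ new? (inj₁ x∈)) , z , ∈-fromDec⁺ new? (inj₂ (inj₁ (inj₁ refl))) , z∉S)

    leaf-exists : ∀ {x} → Body x → ∃ (Leaf x)
    leaf-exists {x} b with nontrivial x
    ... | y , y≢x , e = y , proj₂ (top⇒child (body-top b) e y≢x) , e

    oldEnum : ∃ (Enumeration (_∈ S))
    oldEnum = enumerate (_∈? S)
    m = proj₁ oldEnum
    old : Fin m → Fin n
    old = proj₁ (proj₂ oldEnum)
    oldE : Enumerates (_∈ S) old
    oldE = proj₂ (proj₂ oldEnum)

    bodyEnum : ∃[ k ] Enumeration Body (suc k)
    bodyEnum = enumerate⁺ (peer? z) (z , inj₁ refl)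
    k = proj₁ bodyEnum
    body : Fin (suc k) → Fin n
    body = proj₁ (proj₂ bodyEnum)
    bodyE : Enumerates Body body
    bodyE = proj₂ (proj₂ bodyEnum)

    leafEnum : ∀ i → ∃[ h ] Enumeration (Leaf (body i)) (suc h)
    leafEnum i = enumerate⁺ (leaf? (body i)) (leaf-exists (sound bodyE i))
    h : Fin (suc k) → ℕ
    h i = proj₁ (leafEnum i)
    leaf : ∀ i → Fin (suc (h i)) → Fin n
    leaf i = proj₁ (proj₂ (leafEnum i))
    leafE : ∀ i → Enumerates (Leaf (body i)) (leaf i)
    leafE i = proj₂ (proj₂ (leafEnum i))

    v : Fin m
    v = index oldE pz∈S

    place : Fin m ⊎ CoronaV k h → Fin n
    place (inj₁ x)              = old x
    place (inj₂ (inj₁ i))       = body i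
    place (inj₂ (inj₂ (i , a))) = leaf i a

    placeE : Enumerates (_∈ S⁺) place
    placeE = record { injective = λ {a} {b} → inj a b
                    ; sound = λ a → ∈-fromDec⁺ new? (snd a)
                    ; covering  = λ x∈ → cmp (∈-fromDec⁻ new? x∈) }
      where
      inj : ∀ a b → place a ≡ place b → a ≡ b
      inj (inj₁ x) (inj₁ y) e = cong inj₁ (injective oldE e)
      inj (inj₁ x) (inj₂ (inj₁ i)) e =
        contradiction (subst (_∈ S) e (sound oldE x)) (body∉S (sound bodyE i))
      inj (inj₁ x) (inj₂ (inj₂ (i , a))) e =
        contradiction (subst (_∈ S) e (sound oldE x)) (leaf∉S (sound bodyE i) (sound (leafE i) a))
      inj (inj₂ (inj₁ i)) (inj₁ y) e =
        contradiction (subst (_∈ S) (sym e) (sound oldE y)) (body∉S (sound bodyE i))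
      inj (inj₂ (inj₂ (i , a))) (inj₁ y) e =
        contradiction (subst (_∈ S) (sym e) (sound oldE y)) (leaf∉S (sound bodyE i) (sound (leafE i) a))
      inj (inj₂ (inj₁ i)) (inj₂ (inj₁ j)) e = cong (λ l → inj₂ (inj₁ l)) (injective bodyE e)
      inj (inj₂ (inj₁ i)) (inj₂ (inj₂ (j , b))) e =
        contradiction e (leaf≢body (sound bodyE j) (sound (leafE j) b) (sound bodyE i))
      inj (inj₂ (inj₂ (i , a))) (inj₂ (inj₁ j)) e =
        contradiction (sym e) (leaf≢body (sound bodyE i) (sound (leafE i) a) (sound bodyE j))
      inj (inj₂ (inj₂ (i , a))) (inj₂ (inj₂ (j , b))) e
        -- Taking parents first identifies the two body indices; only then do both leaves belong to
        -- one enumeration.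
        with injective bodyE (trans (sym (proj₁ (sound (leafE i) a)))
               (trans (cong parent e) (proj₁ (sound (leafE j) b))))
      ... | refl = cong (λ c → inj₂ (inj₂ (i , c))) (injective (leafE i) e)

      snd : ∀ a → New (place a)
      snd (inj₁ x)              = inj₁ (sound oldE x)
      snd (inj₂ (inj₁ i))       = inj₂ (inj₁ (sound bodyE i))
      snd (inj₂ (inj₂ (i , a))) = body-class (sound bodyE i) (proj₂ (sound (leafE i) a))

      cmp : ∀ {x} → New x → ∃[ a ] place a ≡ x
      cmp (inj₁ x∈)       = inj₁ (index oldE x∈) , index-spec oldE x∈
      cmp (inj₂ (inj₁ b)) = inj₂ (inj₁ (index bodyE b)) , index-spec bodyE b
      cmp {x} (inj₂ (inj₂ (b , _ , e))) =
        inj₂ (inj₂ (i , index (leafE i) l)) , index-spec (leafE i) l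
        where
        i = index bodyE b
        l : Leaf (body i) x
        l = sym (index-spec bodyE b) , trans e (cong class (sym (index-spec bodyE b)))

    H : Graph (Fin m ⊎ CoronaV k h)
    H = attach (pull G old) v k h

    old-body : ∀ x i → adj G (old x) (body i) ≡ eqF x v
    old-body x i = bool-ext forth back
      where
      forth : Adj G (old x) (body i) → eqF x v ≡ true
      forth a with injective oldE (trans (old-body-adj (sound oldE x) (sound bodyE i) a)
                                         (sym (index-spec oldE pz∈S)))
      ... | refl = eqF-refl x
      back : eqF x v ≡ true → Adj G (old x) (body i)
      back e with refl ← eqF⇒≡ e =
        subst (λ p → Adj G p (body i)) (trans (body-parent (sound bodyE i)) (sym (index-spec oldE pz∈S)))
          (Adj-sym (parent-adj (∉S⇒nonroot (body∉S (sound bodyE i)))))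

    old-leaf : ∀ x i a → adj G (old x) (leaf i a) ≡ false
    old-leaf x i a = Boolₚ.¬-not (old-leaf-adj (sound oldE x) (sound bodyE i) (sound (leafE i) a))

    body-leaf : ∀ i j b → adj G (body i) (leaf j b) ≡ eqF i j
    body-leaf i j b = bool-ext forth back
      where
      forth : Adj G (body i) (leaf j b) → eqF i j ≡ true
      forth a with injective bodyE (body-leaf-adj (sound bodyE i) (sound bodyE j) (sound (leafE j) b) a)
      ... | refl = eqF-refl i
      back : eqF i j ≡ true → Adj G (body i) (leaf j b)
      back e with refl ← eqF⇒≡ e = leaf-body-adj (sound bodyE i) (sound (leafE i) b)

    leaf-leaf : ∀ i a j b → adj G (leaf i a) (leaf j b) ≡ eqF i j ∧ not (toℕ a ≡ᵇ toℕ b)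
    leaf-leaf i a j b with i ≟ j
    ... | no i≢j = Boolₚ.¬-not λ e → i≢j (injective bodyE
            (leaf-leaf-adj (sound bodyE i) (sound (leafE i) a) (sound bodyE j) (sound (leafE j) b) e))
    ... | yes refl with a ≟ b
    ...   | yes refl = trans (proj₂ simple _) (cong not (sym (toℕ-≡ᵇ-refl a)))
    ...   | no a≢b   = trans
            (same-class-adj (trans (proj₂ (sound (leafE i) a)) (sym (proj₂ (sound (leafE i) b))))
              (λ e → a≢b (injective (leafE i) e)))
            (cong not (sym (Boolₚ.¬-not λ e → a≢b (toℕ-≡ᵇ⇒≡ a b e))))

    flip : ∀ {u w b} → adj G u w ≡ b → adj G w u ≡ b
    flip {u} {w} e = trans (proj₁ simple w u) e

    place-adj : ∀ a b → adj G (place a) (place b) ≡ adj H a b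
    place-adj (inj₁ x) (inj₁ y)                           = refl
    place-adj (inj₁ x) (inj₂ (inj₁ i))                    = old-body x i
    place-adj (inj₁ x) (inj₂ (inj₂ (i , a)))              = old-leaf x i a
    place-adj (inj₂ (inj₁ i)) (inj₁ y)                    = flip (old-body y i)
    place-adj (inj₂ (inj₂ (i , a))) (inj₁ y)              = flip (old-leaf y i a)
    place-adj (inj₂ (inj₁ i)) (inj₂ (inj₁ j))             =
      adj≡not-eqF {e = body} (body-body-adj (sound bodyE i) (sound bodyE j)) (injective bodyE)
    place-adj (inj₂ (inj₁ i)) (inj₂ (inj₂ (j , b)))       = body-leaf i j b
    place-adj (inj₂ (inj₂ (i , a))) (inj₂ (inj₁ j))       =
      trans (flip (body-leaf j i a)) (bool-ext (swap j i) (swap i j))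
      where
      swap : ∀ i j → eqF i j ≡ true → eqF j i ≡ true
      swap i j e with refl ← eqF⇒≡ e = eqF-refl i
    place-adj (inj₂ (inj₂ (i , a))) (inj₂ (inj₂ (j , b))) = leaf-leaf i a j b

    represented⁺ : Represented S⁺
    represented⁺ E = extend (rep oldE) v k h _ (enumerations-iso {G = G} E placeE place-adj)

  -- Climbing from a missing vertex must enter `S` at some point, since the root lies in it.
  boundary : ∀ {S} → Saturated S → ∀ k x → depth x ≤ k → x ∉ S → ∃[ z ] (z ∉ S × parent z ∈ S)
  boundary {S} sat k x x≤k x∉S with parent x ∈? S
  ... | yes px∈S = x , x∉S , px∈S
  ... | no px∉S  = ascend k x≤k
    where
    x≢r : x ≢ r
    x≢r refl = x∉S (Saturated.root∈ sat)
    ascend : ∀ k → depth x ≤ k → _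
    ascend k       x≤k with depth x | parent-depth x≢r
    ascend (suc k) x≤k | _ | refl = boundary sat k (parent x) (s≤s⁻¹ x≤k) px∉S

  -- `k` bounds the number of missing vertices, and every attached corona contributes at least `z`.
  grow : ∀ k {S} → n ≤ k + ∣ S ∣ → Saturated S → Represented S → InF G
  grow k {S} n≤ sat rep with any? (λ x → ¬? (x ∈? S))
  ... | no all∈ = rep (record
          { injective = λ e → e
          ; sound     = λ x → decidable-stable (x ∈? S) λ x∉S → all∈ (x , x∉S)
          ; covering  = λ {x} _ → x , refl })
  ... | yes (x , x∉S) with boundary sat (depth x) x ≤-refl x∉S
  ...   | z , z∉S , pz∈S = next k n≤
    where
    open Step sat rep z∉S pz∈S using (S⁺; ∣S∣<∣S⁺∣; saturated⁺; represented⁺)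
    next : ∀ k → n ≤ k + ∣ S ∣ → InF G
    next zero    n≤ = contradiction (≤-trans ∣S∣<∣S⁺∣ (≤-trans (∣p∣≤n S⁺) n≤)) (ℕₚ.<-irrefl refl)
    next (suc k) n≤ = grow k (≤-trans n≤
      (≤-trans (≤-reflexive (sym (ℕₚ.+-suc k ∣ S ∣))) (ℕₚ.+-monoʳ-≤ k ∣S∣<∣S⁺∣)))
      saturated⁺ represented⁺

  cover⇒inF : InF G
  cover⇒inF = grow n (ℕₚ.m≤m+n n _) root-saturated root-represented

theorem4p7 : ∀ {n : ℕ} (G : Graph (Fin n)) → IsSimple G → 2 ≤ n →
    Connected G → IsBlockGraph G →
    (AlphaExcellent G ⇔ InF G) × (InF G ⇔ HasPerfectBlockCover G)
theorem4p7 G simple 2≤n connected blockGraph =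
  mk⇔ (λ excellent → inF (clique-cover class joined (maximal excellent)))
      -- The graph is rooted anew at each vertex `v` for which a maximum independent set is sought.
      (λ G∈F v → CoverStructure.root-in-maximum G simple (rooted v) (inF⇒cover G∈F)) ,
  mk⇔ (λ G∈F → cover⇒blockCover (inF⇒cover G∈F))
      (λ blockCover → inF (blockCover⇒cover blockCover))
  where
  open BlockCover G simple 2≤n connected blockGraph
  rooted : ∀ r → Rooted G r
  rooted = BreadthFirst.rooted G simple connected blockGraph
  root = rooted (vertex 2≤n)
  open Greedy G simple root using (class; joined; maximal)
  inF : CliqueCover G → InF G
  inF = Build.cover⇒inF G simple root
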